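{- Let $G$ be a finite non-abelian group and $m>1$ an integer. Then: (1) the stabilizer of $\mathbf{e}=(e,\dots,e)$ in $\mathbf{Aut}(\mathscr{G}_m(G))$ equals the (internal) direct product $\mathbf{Aut}_m(G)\times\mathbf{\Delta}_m$, which is isomorphic to $\mathbf{Aut}(G)\times D_{m+1}$; (2) $\mathbf{Aut}(\mathscr{G}_m(G))=\big(\mathbf{T}_m\rtimes\mathbf{Aut}_m(G)\big)\rtimes\mathbf{\Delta}_m\simeq\big(G^m\rtimes\mathbf{Aut}(G)\big)\rtimes D_{m+1}$.
   Context: For a finite group $G$ with identity $e$, $G^\times=G\setminus\{e\}$. For $x\in G^\times$ and $1\leqslant k<l\leqslant m+1$, $\mathbf{x}_{[k,l)}\in G^m$ has $j$-th coordinate $x$ for $k\leqslant j<l$ and $e$ otherwise; $\mathcal{S}_{[k,l)}=\{\mathbf{x}_{[k,l)}:x\in G^\times\}$, $\mathcal{S}$ is the union of all $\mathcal{S}_{[k,l)}$, and $\mathscr{G}_m(G)=Cay(G^m,\mathcal{S})$ is the graph on $G^m$ with $\mathbf{g}\sim\mathbf{h}$ iff $\mathbf{h}\mathbf{g}^{ -1}\in\mathcal{S}$. Maps act on the right. $\mathbf{T}_m=\{T_\mathbf{g}:\mathbf{g}\in G^m\}$ with $\mathbf{x}^{T_\mathbf{g}}=\mathbf{x}\mathbf{g}$. $\mathbf{Aut}_m(G)$ is the group of maps $(x_1,\dots,x_m)\mapsto(f(x_1),\dots,f(x_m))$, $f\in\mathbf{Aut}(G)$. $\tau\colon G^m\to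 G^m$ is $(g_1,\dots,g_m)^\tau=(g_m,\dots,g_1)$, $\omega\colon G^m\to G^m$ is $(g_1,\dots,g_m)^\omega=(g_1^{ -1}g_2,g_1^{ -1}g_3,\dots,g_1^{ -1}g_m,g_1^{ -1})$, and $\mathbf{\Delta}_m=\langle\tau,\omega\rangle$. $D_{m+1}$ is the dihedral group of order $2m+2$. -}

module Defs where

open import Level using (0ℓ)
open import Data.Nat using (ℕ; zero; suc; _<_; _≤_; _∸_; _<ᵇ_; _≤ᵇ_)
open import Data.Nat.DivMod using (_mod_)
open import Data.Bool using (Bool; true; false; if_then_else_; _∧_; _xor_)
open import Data.Fin using (Fin; toℕ)
open import Data.Vec using (Vec; []; _∷_; _∷ʳ_; map; zipWith; replicate; reverse; tabulate)
open import Data.List using (List; []; _∷_)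
open import Data.Product using (Σ; ∃; ∃-syntax; _×_; _,_)
open import Relation.Binary.PropositionalEquality using (_≡_; _≢_)
open import Relation.Nullary using (¬_)
open import Algebra.Structures using (IsGroup)
open import Function.Bundles using (_↔_)
open import Function.Definitions using (Bijective)
open import Function using (_∘_; id)

record FinGroup : Set₁ where
  infixl 7 _∙_
  field
    Carrier : Set
    _∙_     : Carrier → Carrier → Carrier
    ε       : Carrier
    _⁻¹     : Carrier → Carrier
    isGroup : IsGroup _≡_ _∙_ ε _⁻¹
    finite  : ∃[ n ] (Carrier ↔ Fin n)

_≗_ : {A B : Set} → (A → B) → (A → B) → Set
f ≗ g = ∀ x → f x ≡ g x

module Cay (G : FinGroup) where
  open FinGroup G

  NonAbelian : Set
  NonAbelian = ¬ (∀ x y → x ∙ y ≡ y ∙ x)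

  IsGroupAut : (Carrier → Carrier) → Set
  IsGroupAut f = Bijective {A = Carrier} _≡_ _≡_ f × (∀ x y → f (x ∙ y) ≡ f x ∙ f y)

  module On (m : ℕ) where
    Gm : Set
    Gm = Vec Carrier m

    _·_ : Gm → Gm → Gm
    _·_ = zipWith _∙_

    inv : Gm → Gm
    inv = map _⁻¹

    𝐞 : Gm
    𝐞 = replicate m ε

    interval : Carrier → ℕ → ℕ → Gm
    interval x k l = tabulate (λ j → if (k ≤ᵇ toℕ j) ∧ (toℕ j <ᵇ l) then x else ε)

    -- connection set S (1-based 1 ≤ k < l ≤ m+1  becomes 0-based  k < l ≤ m)
    InS : Gm → Set
    InS s = ∃[ x ] ∃[ k ] ∃[ l ] (x ≢ ε × k < l × l ≤ m × s ≡ interval x k l)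

    Adj : Gm → Gm → Set
    Adj g h = InS (h · inv g)

    IsGraphAut : (Gm → Gm) → Set
    IsGraphAut φ = Bijective {A = Gm} _≡_ _≡_ φ
                 × (∀ g h → (Adj g h → Adj (φ g) (φ h)) × (Adj (φ g) (φ h) → Adj g h))

    T : Gm → (Gm → Gm)
    T g x = x · g

    autₘ : (Carrier → Carrier) → (Gm → Gm)
    autₘ f = map f

    τ : Gm → Gm
    τ = reverse

    ω : Gm → Gm
    ω [] = []
    ω (g ∷ gs) = map (λ y → (g ⁻¹) ∙ y) gs ∷ʳ (g ⁻¹)

    -- Δ_m = ⟨τ, ω⟩ : maps equal to a finite composite of τ and ω
    -- (true ↦ τ, false ↦ ω; maps act on the right, so a word b₁…b_r is applied left to right).
    -- Since Δ_m is a finite group of permutations, the generated monoid equals the generated group.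
    gen : Bool → (Gm → Gm)
    gen true  = τ
    gen false = ω

    evalW : List Bool → (Gm → Gm)
    evalW []       = id
    evalW (b ∷ w)  = evalW w ∘ gen b

    InΔ : (Gm → Gm) → Set
    InΔ δ = ∃[ w ] (δ ≗ evalW w)

-- The dihedral group D_n of order 2n (n = suc k ≥ 1):
-- (r , s) represents ρ^r σ^s with ρ^n = σ² = 1, σρσ = ρ⁻¹.
Dih : ℕ → Set
Dih k = Fin (suc k) × Bool

dmul : (k : ℕ) → Dih k → Dih k → Dih k
dmul k (r₁ , s₁) (r₂ , s₂) =
  ((toℕ r₁ Data.Nat.+ (if s₁ then (suc k ∸ toℕ r₂) else toℕ r₂)) mod suc k , s₁ xor s₂)

{-# OPTIONS --safe #-}
module Submission where

open import Defs
open import Data.Nat using (ℕ; _<_)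
open import Data.Product using (Σ; ∃; ∃-syntax; _×_; _,_)
open import Relation.Binary.PropositionalEquality using (_≡_)
open import Function using (_∘_; id)

-- Pad g = (g₁, …, g_m) to a = (e, g₁, …, g_m, e) and record the m + 1 quotients aⱼ⁻¹ aⱼ₊₁.  This
-- identifies G^m with the words of length m + 1 over G whose product is e, two elements are adjacent
-- iff their words differ in exactly two positions, ω rotates words, and τ reverses them while
-- inverting the letters.  Counting common neighbours shows that a graph automorphism maps
-- edges at a vertex over the same pair of positions to edges over one pair; a letter x ≠ x⁻¹
-- separates three pairs with a common position from the three pairs in a triple, so the map on pairs
-- comes from a permutation π of the positions, and π is the same at all vertices.  Hence
-- an automorphism fixing 𝐞 permutes positions by π and applies one map f to every letter.  The words
-- with three nontrivial letters show that f is a homomorphism if π preserves the cyclic order of a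
-- triple and an antihomomorphism if it reverses it.  As G is not abelian, one of the two happens for all
-- triples at once, so π is a rotation or a reflection.

open import Level using (0ℓ)
open import Data.Nat as ℕ using (zero; suc; s≤s; z≤n; z<s; s<s; s≤s⁻¹)
import Data.Nat.Properties as ℕ
open import Data.Nat.DivMod using (_mod_; _%_; _/_; m≡m%n+[m/n]*n; m%n<n)
open import Data.Nat.GeneralisedArithmetic using (fold; fold-+)
open import Data.Bool using (Bool; true; false; if_then_else_; _∧_; _xor_)
open import Data.Fin as Fin using (Fin; zero; suc; toℕ; fromℕ; inject₁; opposite; fromℕ<)
import Data.Fin.Properties as Fin
open import Data.Vec as Vec using (Vec; []; _∷_; _∷ʳ_; map; zipWith; replicate; reverse; lookup)
import Data.Vec.Properties as Vec
open import Data.List as List using (List; length; _∷_; [])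
open import Data.List.Relation.Unary.All as All using (All)
import Data.List.Relation.Unary.AllPairs as AllPairs
open import Data.List.Relation.Unary.Unique.Propositional using (Unique)
open import Data.Product using (∃₂; proj₁; proj₂)
open import Data.Sum as Sum using (_⊎_; inj₁; inj₂; [_,_]′)
open import Data.Empty using (⊥; ⊥-elim)
open import Relation.Binary.PropositionalEquality
  using (_≢_; refl; sym; trans; cong; cong₂; subst; subst₂; ≢-sym; module ≡-Reasoning)
open import Relation.Nullary using (¬_; Dec; yes; no; contradiction; does; ¬?)
open import Relation.Nullary.Decidable using (_×-dec_; decidable-stable; map′)
open import Relation.Binary.Definitions using (DecidableEquality; tri<; tri≈; tri>)
open import Function using (Inverse)
open import Function.Properties.Inverse using (Inverse⇒Injection)
open import Algebra.Bundles using (Group)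

-- The obstacle is `m = 2`: among three positions no two pairs are disjoint, so the test by common
-- neighbours distinguishes nothing, and only the number of vertices over one pair keeps an
-- automorphism from spreading it over two pairs. That count asks for five group elements.
-- Non-commutativity enters in four ways. It supplies the five elements; it supplies a letter that
-- is not its own inverse; it keeps `f` from being a homomorphism and an antihomomorphism at once;
-- and it keeps inversion from being a group automorphism, so that the entrywise automorphisms meet
-- the dihedral part trivially. A right translation does not act on words by one letter map: at each
-- position it multiplies the letter on both sides by fixed elements. It thus preserves equality of
-- letters, which is all that adjacency sees. Carried through `ω`, a translation leaves a
-- conjugation behind, so the dihedral part normalizes the translations only together with the group
-- automorphisms.

-- Words of successive quotients.

module Differences (G : FinGroup) where

  open FinGroup G
  open Cay G

  group : Group 0ℓ 0ℓ
  group = record { isGroup = isGroup }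

  open Group group public using (assoc; identityˡ; identityʳ; inverseˡ; inverseʳ; _\\_; _//_)
  open import Algebra.Properties.Group group public

  private variable
    m : ℕ

  -- Both ends are parameters because the recursion moves the left one, and because comparing,
  -- translating and rotating sequences all lead to ends other than `ε`.
  diffs : Carrier → Vec Carrier m → Carrier → Vec Carrier (suc m)
  diffs p []       q = (p \\ q) ∷ []
  diffs p (x ∷ xs) q = (p \\ x) ∷ diffs x xs q

  \\-cancelʳ : ∀ {p p′} q → p \\ q ≡ p′ \\ q → p ≡ p′
  \\-cancelʳ q eq = ⁻¹-injective (∙-cancelʳ q _ _ eq)

  \\-cancelˡ : ∀ p {q q′} → p \\ q ≡ p \\ q′ → q ≡ q′
  \\-cancelˡ p eq = ∙-cancelˡ (p ⁻¹) _ _ eq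

  \\-cancel-common : ∀ c p q → (c ∙ p) \\ (c ∙ q) ≡ p \\ q
  \\-cancel-common c p q = begin
    (c ∙ p) ⁻¹ ∙ (c ∙ q)      ≡⟨ cong (_∙ (c ∙ q)) (⁻¹-anti-homo-∙ c p) ⟩
    p ⁻¹ ∙ c ⁻¹ ∙ (c ∙ q)     ≡⟨ assoc _ _ _ ⟩
    p ⁻¹ ∙ (c ⁻¹ ∙ (c ∙ q))   ≡⟨ cong (p ⁻¹ ∙_) (\\-leftDividesʳ c q) ⟩
    p ⁻¹ ∙ q                  ∎
    where open ≡-Reasoning

  \\-∙-conj : ∀ p q s t → (p ∙ s) \\ (q ∙ t) ≡ s ⁻¹ ∙ (p \\ q) ∙ t
  \\-∙-conj p q s t = begin
    (p ∙ s) ⁻¹ ∙ (q ∙ t)       ≡⟨ cong (_∙ (q ∙ t)) (⁻¹-anti-homo-∙ p s) ⟩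
    s ⁻¹ ∙ p ⁻¹ ∙ (q ∙ t)      ≡⟨ sym (assoc _ _ _) ⟩
    s ⁻¹ ∙ p ⁻¹ ∙ q ∙ t        ≡⟨ cong (_∙ t) (assoc _ _ _) ⟩
    s ⁻¹ ∙ (p ⁻¹ ∙ q) ∙ t      ∎
    where open ≡-Reasoning

  \\-telescope : ∀ p q r → (p \\ q) ∙ (q \\ r) ≡ p \\ r
  \\-telescope p q r = trans (assoc _ _ _) (cong (p ⁻¹ ∙_) (\\-leftDividesˡ q r))

  diffs-injective : ∀ p p′ (g g′ : Vec Carrier m) q →
    (∀ j → lookup (diffs p g q) j ≡ lookup (diffs p′ g′ q) j) → p ≡ p′ × g ≡ g′
  diffs-injective p p′ [] [] q eq = \\-cancelʳ q (eq zero) , refl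
  diffs-injective p p′ (x ∷ g) (x′ ∷ g′) q eq with diffs-injective x x′ g g′ q (eq ∘ suc)
  ... | refl , refl = \\-cancelʳ x (eq zero) , refl

  -- Entries before the gap `k` are recovered forwards from `p`, those after it backwards from `q`.
  diffs-determined : ∀ p (g g′ : Vec Carrier m) q k →
    (∀ j → j ≢ k → lookup (diffs p g q) j ≡ lookup (diffs p g′ q) j) → g ≡ g′
  diffs-determined p [] [] q k eq = refl
  diffs-determined p (x ∷ g) (x′ ∷ g′) q zero eq
    with diffs-injective x x′ g g′ q (λ j → eq (suc j) λ ())
  ... | refl , refl = refl
  diffs-determined p (x ∷ g) (x′ ∷ g′) q (suc k) eq with \\-cancelˡ p (eq zero λ ())
  ... | refl = cong (x ∷_) (diffs-determined x g g′ q k λ j j≢k → eq (suc j) (j≢k ∘ Fin.suc-injective))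

  diffs-surjective : ∀ (w : Fin (suc m) → Carrier) q →
    ∃₂ λ p (g : Vec Carrier m) → ∀ j → lookup (diffs p g q) j ≡ w j
  diffs-surjective {zero} w q = q // w zero , [] , λ { zero → lemma }
    where
    lemma : (q // w zero) \\ q ≡ w zero
    lemma = trans (cong (_∙ q) (⁻¹-anti-homo-// q (w zero))) (//-rightDividesˡ q (w zero))
  diffs-surjective {suc m} w q with diffs-surjective (w ∘ suc) q
  ... | x , g , eq = x // w zero , x ∷ g , λ { zero → lemma ; (suc j) → eq j }
    where
    lemma : (x // w zero) \\ x ≡ w zero
    lemma = trans (cong (_∙ x) (⁻¹-anti-homo-// x (w zero))) (//-rightDividesˡ x (w zero))

  -- Build forwards from `p` up to `k` and backwards from `q` down to it; the letter at `k` is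
  -- whatever makes the two halves fit.
  diffs-prescribed : ∀ p (w : Fin (suc m) → Carrier) q k →
    ∃ λ (g : Vec Carrier m) → ∀ j → j ≢ k → lookup (diffs p g q) j ≡ w j
  diffs-prescribed {zero}  p w q zero = [] , λ { zero 0≢0 → contradiction refl 0≢0 }
  diffs-prescribed {suc m} p w q zero with diffs-surjective (w ∘ suc) q
  ... | x , g , eq = x ∷ g , λ { zero 0≢0 → contradiction refl 0≢0 ; (suc j) _ → eq j }
  diffs-prescribed {suc m} p w q (suc k) with diffs-prescribed (p ∙ w zero) (w ∘ suc) q k
  ... | g , eq = p ∙ w zero ∷ g , λ where
    zero    _     → \\-leftDividesʳ p (w zero)
    (suc j) sj≢sk → eq j (sj≢sk ∘ cong suc)

  -- Translation multiplies a letter on the left and on the right by factors that come from `h` or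
  -- the ends and depend on the position alone, so equal letters stay equal.
  diffs-translate : ∀ p p′ (g g′ h : Vec Carrier m) q s t j →
    lookup (diffs p g q) j ≡ lookup (diffs p′ g′ q) j →
    lookup (diffs (p ∙ s) (zipWith _∙_ g h) (q ∙ t)) j ≡ lookup (diffs (p′ ∙ s) (zipWith _∙_ g′ h) (q ∙ t)) j
  diffs-translate p p′ [] [] [] q s t zero eq =
    trans (\\-∙-conj p q s t) (trans (cong (λ z → s ⁻¹ ∙ z ∙ t) eq) (sym (\\-∙-conj p′ q s t)))
  diffs-translate p p′ (x ∷ g) (x′ ∷ g′) (y ∷ h) q s t zero eq =
    trans (\\-∙-conj p x s y) (trans (cong (λ z → s ⁻¹ ∙ z ∙ y) eq) (sym (\\-∙-conj p′ x′ s y)))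
  diffs-translate p p′ (x ∷ g) (x′ ∷ g′) (y ∷ h) q s t (suc j) eq = diffs-translate x x′ g g′ h q y t j eq

  diffs-∷ʳ : ∀ p (g : Vec Carrier m) x q → diffs p (g ∷ʳ x) q ≡ diffs p g x ∷ʳ (x \\ q)
  diffs-∷ʳ p []      x q = refl
  diffs-∷ʳ p (y ∷ g) x q = cong ((p \\ y) ∷_) (diffs-∷ʳ y g x q)

  diffs-map-∙ : ∀ c p (g : Vec Carrier m) q → diffs (c ∙ p) (map (c ∙_) g) (c ∙ q) ≡ diffs p g q
  diffs-map-∙ c p []      q = cong (_∷ []) (\\-cancel-common c p q)
  diffs-map-∙ c p (x ∷ g) q = cong₂ _∷_ (\\-cancel-common c p x) (diffs-map-∙ c x g q)

  diffs-reverse : ∀ p (g : Vec Carrier m) q → diffs q (reverse g) p ≡ reverse (map _⁻¹ (diffs p g q))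
  diffs-reverse p []      q = cong (_∷ []) (sym (⁻¹-anti-homo-\\ p q))
  diffs-reverse p (x ∷ g) q = begin
    diffs q (reverse (x ∷ g)) p                               ≡⟨ cong (λ r → diffs q r p) (Vec.reverse-∷ x g) ⟩
    diffs q (reverse g ∷ʳ x) p                                ≡⟨ diffs-∷ʳ q (reverse g) x p ⟩
    diffs q (reverse g) x ∷ʳ (x \\ p)                         ≡⟨ cong₂ _∷ʳ_ (diffs-reverse x g q) (sym (⁻¹-anti-homo-\\ p x)) ⟩
    reverse (map _⁻¹ (diffs x g q)) ∷ʳ ((p \\ x) ⁻¹)          ≡⟨ sym (Vec.reverse-∷ _ (map _⁻¹ (diffs x g q))) ⟩
    reverse (map _⁻¹ (diffs p (x ∷ g) q))                     ∎
    where open ≡-Reasoning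

  diffs-hom : ∀ (f : Carrier → Carrier) → (∀ x y → f (x \\ y) ≡ f x \\ f y) → ∀ p (g : Vec Carrier m) q →
    diffs (f p) (map f g) (f q) ≡ map f (diffs p g q)
  diffs-hom f hom p []      q = cong (_∷ []) (sym (hom p q))
  diffs-hom f hom p (x ∷ g) q = cong₂ _∷_ (sym (hom p x)) (diffs-hom f hom x g q)

  lookup-∷ʳ-fromℕ : ∀ {A : Set} (xs : Vec A m) x → lookup (xs ∷ʳ x) (fromℕ m) ≡ x
  lookup-∷ʳ-fromℕ []       x = refl
  lookup-∷ʳ-fromℕ (_ ∷ xs) x = lookup-∷ʳ-fromℕ xs x

  lookup-∷ʳ-inject₁ : ∀ {A : Set} (xs : Vec A m) x i → lookup (xs ∷ʳ x) (inject₁ i) ≡ lookup xs i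
  lookup-∷ʳ-inject₁ (_ ∷ xs) x zero    = refl
  lookup-∷ʳ-inject₁ (_ ∷ xs) x (suc i) = lookup-∷ʳ-inject₁ xs x i

  lookup-reverse : ∀ {A : Set} (xs : Vec A m) i → lookup (reverse xs) (opposite i) ≡ lookup xs i
  lookup-reverse (x ∷ xs) zero    rewrite Vec.reverse-∷ x xs = lookup-∷ʳ-fromℕ (reverse xs) x
  lookup-reverse (x ∷ xs) (suc i) rewrite Vec.reverse-∷ x xs =
    trans (lookup-∷ʳ-inject₁ (reverse xs) x (opposite i)) (lookup-reverse xs i)

  ∏ : Vec Carrier m → Carrier
  ∏ []       = ε
  ∏ (x ∷ xs) = x ∙ ∏ xs

  ∏-diffs : ∀ p (g : Vec Carrier m) q → ∏ (diffs p g q) ≡ p \\ q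
  ∏-diffs p []      q = identityʳ _
  ∏-diffs p (x ∷ g) q = trans (cong ((p \\ x) ∙_) (∏-diffs x g q)) (\\-telescope p x q)

  ∏-trivial : ∀ (w : Vec Carrier m) → (∀ j → lookup w j ≡ ε) → ∏ w ≡ ε
  ∏-trivial []      w≡ε = refl
  ∏-trivial (x ∷ w) w≡ε = trans (cong₂ _∙_ (w≡ε zero) (∏-trivial w (w≡ε ∘ suc))) (identityˡ ε)

  ∏-support₁ : ∀ (w : Vec Carrier m) k → (∀ j → j ≢ k → lookup w j ≡ ε) → ∏ w ≡ lookup w k
  ∏-support₁ (x ∷ w) zero    w≡ε = trans (cong (x ∙_) (∏-trivial w λ j → w≡ε (suc j) λ ())) (identityʳ x)
  ∏-support₁ (x ∷ w) (suc k) w≡ε = trans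
    (cong₂ _∙_ (w≡ε zero λ ()) (∏-support₁ w k λ j j≢k → w≡ε (suc j) (j≢k ∘ Fin.suc-injective)))
    (identityˡ _)

  ∏-support₂ : ∀ (w : Vec Carrier m) {i k} → i Fin.< k → (∀ j → j ≢ i → j ≢ k → lookup w j ≡ ε) →
    ∏ w ≡ lookup w i ∙ lookup w k
  ∏-support₂ (x ∷ w) {zero}  {suc k} _       w≡ε =
    cong (x ∙_) (∏-support₁ w k λ j j≢k → w≡ε (suc j) (λ ()) (j≢k ∘ Fin.suc-injective))
  ∏-support₂ (x ∷ w) {suc i} {suc k} (s<s i<k) w≡ε = trans
    (cong₂ _∙_ (w≡ε zero (λ ()) (λ ()))
      (∏-support₂ w i<k λ j j≢i j≢k → w≡ε (suc j) (j≢i ∘ Fin.suc-injective) (j≢k ∘ Fin.suc-injective)))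
    (identityˡ _)

  ∏-support₃ : ∀ (w : Vec Carrier m) {i j k} → i Fin.< j → j Fin.< k →
    (∀ l → l ≢ i → l ≢ j → l ≢ k → lookup w l ≡ ε) → ∏ w ≡ lookup w i ∙ (lookup w j ∙ lookup w k)
  ∏-support₃ (x ∷ w) {zero} {suc j} {suc k} _ (s<s j<k) w≡ε =
    cong (x ∙_) (∏-support₂ w j<k λ l l≢j l≢k →
      w≡ε (suc l) (λ ()) (l≢j ∘ Fin.suc-injective) (l≢k ∘ Fin.suc-injective))
  ∏-support₃ (x ∷ w) {suc i} {suc j} {suc k} (s<s i<j) (s<s j<k) w≡ε = trans
    (cong₂ _∙_ (w≡ε zero (λ ()) (λ ()) (λ ()))
      (∏-support₃ w i<j j<k λ l l≢i l≢j l≢k → w≡ε (suc l)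
        (l≢i ∘ Fin.suc-injective) (l≢j ∘ Fin.suc-injective) (l≢k ∘ Fin.suc-injective)))
    (identityˡ _)

-- Adjacency as a difference in exactly two letters.

module Adjacency (G : FinGroup) where

  open FinGroup G
  open Cay G
  open Differences G

  private variable
    m : ℕ

  interval : ∀ m → Carrier → ℕ → ℕ → Vec Carrier m
  interval m = On.interval m

  interval-suc : ∀ x k l → interval (suc m) x (suc k) (suc l) ≡ ε ∷ interval m x k l
  interval-suc x k l = cong (ε ∷_) (Vec.tabulate-cong λ j →
    cong (λ b → if b ∧ (toℕ j ℕ.<ᵇ l) then x else ε) (suc-≤ᵇ k (toℕ j)))
    where
    suc-≤ᵇ : ∀ k j → (suc k ℕ.≤ᵇ suc j) ≡ (k ℕ.≤ᵇ j)
    suc-≤ᵇ zero    j = refl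
    suc-≤ᵇ (suc k) j = refl

  ratio : Vec Carrier m → Vec Carrier m → Vec Carrier m
  ratio g h = zipWith _∙_ h (map _⁻¹ g)

  -- The right side is the all-`ε` vector for every `x`; keeping `x` makes this the base case of
  -- `ratio-inside`.
  ratio-self : ∀ x (g : Vec Carrier m) → ratio g g ≡ interval m x 0 0
  ratio-self x []      = refl
  ratio-self x (y ∷ g) = cong₂ _∷_ (inverseʳ y) (ratio-self x g)

  ratio-self⁻¹ : ∀ x (g h : Vec Carrier m) → ratio g h ≡ interval m x 0 0 → h ≡ g
  ratio-self⁻¹ x []      []      eq = refl
  ratio-self⁻¹ x (y ∷ g) (z ∷ h) eq =
    cong₂ _∷_ (x∙y⁻¹≈ε⇒x≈y z y (Vec.∷-injectiveˡ eq)) (ratio-self⁻¹ x g h (Vec.∷-injectiveʳ eq))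

  -- The invariant inside an interval: the sequence behind `h` is `x` times the one behind `g`.
  -- Equal letters carry the factor `x` on to the next entry; beyond `k` the letters agree up to the
  -- common end `q`, so the entries coincide.
  ratio-inside : ∀ x p (g h : Vec Carrier m) q k →
    (∀ j → j ≢ k → lookup (diffs p g q) j ≡ lookup (diffs (x ∙ p) h q) j) →
    ratio g h ≡ interval m x 0 (toℕ k)
  ratio-inside x p [] [] q k eq = refl
  ratio-inside x p (y ∷ g) (z ∷ h) q zero eq with diffs-injective y z g h q (λ j → eq (suc j) λ ())
  ... | refl , refl = ratio-self x (y ∷ g)
  ratio-inside {suc m} x p (y ∷ g) (z ∷ h) q (suc k) eq with z≡x∙y
    where
    z≡x∙y : z ≡ x ∙ y
    z≡x∙y = \\-cancelˡ (x ∙ p) (trans (sym (eq zero λ ())) (sym (\\-cancel-common x p y)))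
  ... | refl = cong₂ _∷_ (//-rightDividesʳ y x)
    (ratio-inside x y g h q k λ j j≢k → eq (suc j) (j≢k ∘ Fin.suc-injective))

  -- The sequences run together up to letter `i`; from the next entry on the invariant of
  -- `ratio-inside` holds, with `x` the quotient of the two entries there.
  ratio-outside : ∀ p (g h : Vec Carrier m) q {i k} → i Fin.< k →
    lookup (diffs p g q) i ≢ lookup (diffs p h q) i →
    (∀ j → j ≢ i → j ≢ k → lookup (diffs p g q) j ≡ lookup (diffs p h q) j) →
    ∃ λ x → x ≢ ε × ratio g h ≡ interval m x (toℕ i) (toℕ k)
  ratio-outside p [] [] q {zero} {zero} () q≢ eq
  ratio-outside p (y ∷ g) (z ∷ h) q {zero} {suc k} _ q≢ eq = z // y , x≢ε , cong₂ _∷_ refl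
    (ratio-inside (z // y) y g h q k λ j j≢k →
      trans (eq (suc j) (λ ()) (j≢k ∘ Fin.suc-injective))
        (cong (λ z′ → lookup (diffs z′ h q) j) (sym (//-rightDividesˡ y z))))
    where
    x≢ε : z // y ≢ ε
    x≢ε eqε = q≢ (cong (p \\_) (sym (x∙y⁻¹≈ε⇒x≈y z y eqε)))
  ratio-outside p (y ∷ g) (z ∷ h) q {suc i} {suc k} (s<s i<k) q≢ eq with \\-cancelˡ p (eq zero (λ ()) (λ ()))
  ... | refl with ratio-outside y g h q i<k q≢
        (λ j j≢i j≢k → eq (suc j) (j≢i ∘ Fin.suc-injective) (j≢k ∘ Fin.suc-injective))
  ...   | x , x≢ε , r≡ = x , x≢ε , trans (cong₂ _∷_ (inverseʳ y) r≡) (sym (interval-suc x (toℕ i) (toℕ k)))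

  ratio-inside⁻¹ : ∀ {x} → x ≢ ε → ∀ p (g h : Vec Carrier m) q k → ratio g h ≡ interval m x 0 (toℕ k) →
    lookup (diffs p g q) k ≢ lookup (diffs (x ∙ p) h q) k ×
    (∀ j → j ≢ k → lookup (diffs p g q) j ≡ lookup (diffs (x ∙ p) h q) j)
  ratio-inside⁻¹ x≢ε p [] [] q zero r≡ =
    (λ eq → x≢ε (identityˡ-unique _ p (sym (\\-cancelʳ q eq)))) , λ { zero 0≢0 → contradiction refl 0≢0 }
  ratio-inside⁻¹ {x = x} x≢ε p (y ∷ g) (z ∷ h) q zero r≡ with ratio-self⁻¹ x (y ∷ g) (z ∷ h) r≡
  ... | refl = (λ eq → x≢ε (identityˡ-unique _ p (sym (\\-cancelʳ y eq)))) , λ where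
    zero    0≢0 → contradiction refl 0≢0
    (suc j) _   → refl
  ratio-inside⁻¹ {x = x} x≢ε p (y ∷ g) (z ∷ h) q (suc k) r≡ with z≡x∙y
    where
    z≡x∙y : z ≡ x ∙ y
    z≡x∙y = trans (sym (//-rightDividesˡ y z)) (cong (_∙ y) (Vec.∷-injectiveˡ r≡))
  ... | refl with ratio-inside⁻¹ x≢ε y g h q k (Vec.∷-injectiveʳ r≡)
  ...   | q≢ , eq = q≢ , λ where
    zero    _     → sym (\\-cancel-common x p y)
    (suc j) sj≢sk → eq j (sj≢sk ∘ cong suc)

  ratio-outside⁻¹ : ∀ {x} → x ≢ ε → ∀ p (g h : Vec Carrier m) q {i k} → i Fin.< k →
    ratio g h ≡ interval m x (toℕ i) (toℕ k) →
    lookup (diffs p g q) i ≢ lookup (diffs p h q) i ×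
    lookup (diffs p g q) k ≢ lookup (diffs p h q) k ×
    (∀ j → j ≢ i → j ≢ k → lookup (diffs p g q) j ≡ lookup (diffs p h q) j)
  ratio-outside⁻¹ x≢ε p [] [] q {zero} {zero} () r≡
  ratio-outside⁻¹ {x = x} x≢ε p (y ∷ g) (z ∷ h) q {zero} {suc k} _ r≡ with z≡x∙y
    where
    z≡x∙y : z ≡ x ∙ y
    z≡x∙y = trans (sym (//-rightDividesˡ y z)) (cong (_∙ y) (Vec.∷-injectiveˡ r≡))
  ... | refl with ratio-inside⁻¹ x≢ε y g h q k (Vec.∷-injectiveʳ r≡)
  ...   | q≢ , eq = (λ eq → x≢ε (identityˡ-unique _ y (sym (\\-cancelˡ p eq)))) , q≢ , λ where
    zero    0≢0 _     → contradiction refl 0≢0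
    (suc j) _   sj≢sk → eq j (sj≢sk ∘ cong suc)
  ratio-outside⁻¹ {x = x} x≢ε p (y ∷ g) (z ∷ h) q {suc i} {suc k} (s<s i<k) r≡
    with r≡′ ← trans r≡ (interval-suc x (toℕ i) (toℕ k))
    with x∙y⁻¹≈ε⇒x≈y z y (Vec.∷-injectiveˡ r≡′) | ratio-outside⁻¹ x≢ε y g h q i<k (Vec.∷-injectiveʳ r≡′)
  ... | refl | ≢ᵢ , ≢ₖ , eq = ≢ᵢ , ≢ₖ , λ where
    zero    _     _     → refl
    (suc j) sj≢si sj≢sk → eq j (sj≢si ∘ cong suc) (sj≢sk ∘ cong suc)

  -- The letters aⱼ⁻¹ aⱼ₊₁ of the padded sequence a = (ε, g₁, …, g_m, ε), indexed from 0.
  coord : Vec Carrier m → Fin (suc m) → Carrier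
  coord g = lookup (diffs ε g ε)

  record Differ (i k : Fin (suc m)) (g h : Vec Carrier m) : Set where
    constructor differ
    field
      distinct : i ≢ k
      ≢ˡ       : coord g i ≢ coord h i
      ≢ʳ       : coord g k ≢ coord h k
      agree    : ∀ j → j ≢ i → j ≢ k → coord g j ≡ coord h j

  _∼_ : Vec Carrier m → Vec Carrier m → Set
  g ∼ h = ∃₂ λ i k → Differ i k g h

  differ-swap : ∀ {i k} {g h : Vec Carrier m} → Differ i k g h → Differ k i g h
  differ-swap (differ i≢k ≢ᵢ ≢ₖ eq) = differ (≢-sym i≢k) ≢ₖ ≢ᵢ λ j j≢k j≢i → eq j j≢i j≢k

  differ-sym : ∀ {i k} {g h : Vec Carrier m} → Differ i k g h → Differ i k h g
  differ-sym (differ i≢k ≢ᵢ ≢ₖ eq) = differ i≢k (≢-sym ≢ᵢ) (≢-sym ≢ₖ) λ j j≢i j≢k → sym (eq j j≢i j≢k)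

  -- Entry `j`, counted from 0, lies between the letters `j` and `j + 1`. An interval from `k` up to
  -- but excluding `l` therefore changes the letters `k` and `l` at its boundaries, without any
  -- shift, and `l = m` is the last letter.
  adj⇒∼ : ∀ {g h : Vec Carrier m} → On.Adj m g h → g ∼ h
  adj⇒∼ {m} {g} {h} (x , k , l , x≢ε , k<l , l≤m , r≡) = kf , lf , differ (Fin.<⇒≢ k<l′) ≢ₖ ≢ₗ eq
    where
    k≤m = ℕ.≤-trans (ℕ.<⇒≤ k<l) l≤m
    kf = fromℕ< (s≤s k≤m)
    lf = fromℕ< (s≤s l≤m)
    k<l′ : kf Fin.< lf
    k<l′ = subst₂ ℕ._<_ (sym (Fin.toℕ-fromℕ< (s≤s k≤m))) (sym (Fin.toℕ-fromℕ< (s≤s l≤m))) k<l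
    result = ratio-outside⁻¹ x≢ε ε g h ε k<l′ (trans r≡
      (sym (cong₂ (interval m x) (Fin.toℕ-fromℕ< (s≤s k≤m)) (Fin.toℕ-fromℕ< (s≤s l≤m)))))
    ≢ₖ = proj₁ result
    ≢ₗ = proj₁ (proj₂ result)
    eq = proj₂ (proj₂ result)

  ∼⇒adj : ∀ {g h : Vec Carrier m} → g ∼ h → On.Adj m g h
  ∼⇒adj {m} {g} {h} (i , k , differ i≢k ≢ᵢ ≢ₖ eq) with Fin.<-cmp i k
  ... | tri≈ _ i≡k _ = contradiction i≡k i≢k
  ... | tri< i<k _ _ with ratio-outside ε g h ε i<k ≢ᵢ eq
  ...   | x , x≢ε , r≡ = x , toℕ i , toℕ k , x≢ε , i<k , s≤s⁻¹ (Fin.toℕ<n k) , r≡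
  ∼⇒adj {m} {g} {h} (i , k , differ i≢k ≢ᵢ ≢ₖ eq) | tri> _ _ k<i
    with ratio-outside ε g h ε k<i ≢ₖ (λ j j≢k j≢i → eq j j≢i j≢k)
  ...   | x , x≢ε , r≡ = x , toℕ k , toℕ i , x≢ε , k<i , s≤s⁻¹ (Fin.toℕ<n i) , r≡

-- Lines through a vertex and their relative position.

module Lines (G : FinGroup) (nonAbelian : Cay.NonAbelian G) where

  open FinGroup G
  open Differences G
  open Adjacency G

  private variable
    m : ℕ

  _≟_ : DecidableEquality Carrier
  _≟_ = Fin.inj⇒≟ (Inverse⇒Injection (proj₂ finite))

  all?-Carrier : ∀ {P : Carrier → Set} → (∀ x → Dec (P x)) → Dec (∀ x → P x)
  all?-Carrier {P} P? = map′
    (λ p x → subst P (Inverse.strictlyInverseʳ enum x) (p (Inverse.to enum x)))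
    (λ p → p ∘ Inverse.from enum)
    (Fin.all? (P? ∘ Inverse.from enum))
    where enum = proj₂ finite

  noncommuting : ∃₂ λ x y → x ∙ y ≢ y ∙ x
  noncommuting = from i , from j , xy≢yx
    where
    enum = proj₂ finite
    open Inverse enum using (to; from; strictlyInverseʳ)
    all-x? = λ i → all?-Carrier (λ y → (from i ∙ y) ≟ (y ∙ from i))
    x-witness = Fin.¬∀⟶∃¬ _ _ all-x? λ comm → nonAbelian λ x y →
      subst (λ z → z ∙ y ≡ y ∙ z) (strictlyInverseʳ x) (comm (to x) y)
    i = proj₁ x-witness
    y-witness = Fin.¬∀⟶∃¬ _ _ (λ j → (from i ∙ from j) ≟ (from j ∙ from i)) λ comm →
      proj₂ x-witness λ y → subst (λ z → from i ∙ z ≡ z ∙ from i) (strictlyInverseʳ y) (comm (to y))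
    j = proj₁ y-witness
    xy≢yx = proj₂ y-witness

  opaque
    -- If `a`, `b` and `a ∙ b` were all their own inverses, `a` and `b` would commute.
    nonInvolution : ∃ λ x → x ≢ x ⁻¹
    nonInvolution with noncommuting
    ... | a , b , ab≢ba with a ≟ (a ⁻¹) | b ≟ (b ⁻¹) | (a ∙ b) ≟ ((a ∙ b) ⁻¹)
    ...   | no a≢   | _       | _       = a , a≢
    ...   | yes _   | no b≢   | _       = b , b≢
    ...   | yes _   | yes _   | no ab≢  = a ∙ b , ab≢
    ...   | yes a≡  | yes b≡  | yes ab≡ = contradiction
      (trans ab≡ (trans (⁻¹-anti-homo-∙ a b) (cong₂ _∙_ (sym b≡) (sym a≡)))) ab≢ba

  -- Five is what `avoid` asks for: two values outside any given three.
  fiveElements : ∃ λ xs → Unique xs × length xs ≡ 5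
  fiveElements with noncommuting
  ... | a , b , ab≢ba = ε List.∷ a List.∷ b List.∷ a ∙ b List.∷ b ∙ a List.∷ List.[] , distinct , refl
    where
    a≢ε : a ≢ ε
    a≢ε refl = ab≢ba (trans (identityˡ b) (sym (identityʳ b)))
    b≢ε : b ≢ ε
    b≢ε refl = ab≢ba (trans (identityʳ a) (sym (identityˡ a)))
    ab≢ε : a ∙ b ≢ ε
    ab≢ε eq with refl ← inverseʳ-unique a b eq = ab≢ba (trans (inverseʳ a) (sym (inverseˡ a)))
    ba≢ε : b ∙ a ≢ ε
    ba≢ε eq with refl ← inverseˡ-unique b a eq = ab≢ba (trans (inverseʳ a) (sym (inverseˡ a)))
    distinct = ((≢-sym a≢ε) All.∷ (≢-sym b≢ε) All.∷ (≢-sym ab≢ε) All.∷ (≢-sym ba≢ε) All.∷ All.[])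
      AllPairs.∷ ((λ { refl → ab≢ba refl }) All.∷ (λ eq → b≢ε (identityʳ-unique a b (sym eq)))
                   All.∷ (λ eq → b≢ε (identityˡ-unique b a (sym eq))) All.∷ All.[])
      AllPairs.∷ ((λ eq → a≢ε (identityˡ-unique a b (sym eq)))
                   All.∷ (λ eq → a≢ε (identityʳ-unique b a (sym eq))) All.∷ All.[])
      AllPairs.∷ (ab≢ba All.∷ All.[])
      AllPairs.∷ All.[] AllPairs.∷ AllPairs.[]

  remove : ∀ {P : Carrier → Set} y xs → Unique xs → All P xs →
    ∃ λ ys → Unique ys × All P ys × All (y ≢_) ys × length xs ℕ.≤ suc (length ys)
  remove y List.[] _ _ = List.[] , AllPairs.[] , All.[] , All.[] , z≤n
  remove y (x List.∷ xs) (x∉xs AllPairs.∷ uniq) (px All.∷ pxs) with y ≟ x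
  ... | yes refl = xs , uniq , pxs , x∉xs , ℕ.≤-refl
  -- The recursion carries `x ≢_` along with `P`, so that uniqueness survives when `x` is put back.
  ... | no  y≢x  with remove y xs uniq (All.zip (x∉xs , pxs))
  ...   | ys , uniq′ , pys , y∉ys , len = x List.∷ ys , All.map proj₁ pys AllPairs.∷ uniq′ ,
          px All.∷ All.map proj₂ pys , y≢x All.∷ y∉ys , s≤s len

  Avoids : Carrier → Carrier → Carrier → Carrier → Set
  Avoids x y z p = x ≢ p × y ≢ p × z ≢ p

  avoid-in : ∀ xs → Unique xs → 5 ℕ.≤ length xs → ∀ x y z → ∃₂ λ p q → p ≢ q × Avoids x y z p × Avoids x y z q
  avoid-in xs uniq len x y z
    with xs₁ , uniq₁ , _  , x∉ , len₁ ← remove x xs uniq (All.universal (λ _ → refl {x = x}) xs)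
    with xs₂ , uniq₂ , x∉ , y∉ , len₂ ← remove y xs₁ uniq₁ x∉
    with xs₃ , uniq₃ , xy∉ , z∉ , len₃ ← remove z xs₂ uniq₂ (All.zip (x∉ , y∉))
    = firstTwo xs₃ uniq₃ xy∉ z∉
        (s≤s⁻¹ (s≤s⁻¹ (s≤s⁻¹ (ℕ.≤-trans len (ℕ.≤-trans len₁ (s≤s (ℕ.≤-trans len₂ (s≤s len₃))))))))
    where
    firstTwo : ∀ ps → Unique ps → All (λ p → x ≢ p × y ≢ p) ps → All (z ≢_) ps → 2 ℕ.≤ length ps →
      ∃₂ λ p q → p ≢ q × Avoids x y z p × Avoids x y z q
    firstTwo (p List.∷ q List.∷ _) ((p≢q All.∷ _) AllPairs.∷ _)
      ((x≢p , y≢p) All.∷ (x≢q , y≢q) All.∷ _) (z≢p All.∷ z≢q All.∷ _) _ =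
        p , q , p≢q , (x≢p , y≢p , z≢p) , (x≢q , y≢q , z≢q)
    firstTwo (_ List.∷ List.[]) _ _ _ (s≤s ())

  opaque
    avoid : ∀ x y z → ∃₂ λ p q → p ≢ q × Avoids x y z p × Avoids x y z q
    avoid = let xs , uniq , len = fiveElements in avoid-in xs uniq (ℕ.≤-reflexive (sym len))

  coord-𝐞 : ∀ (j : Fin (suc m)) → coord (replicate m ε) j ≡ ε
  coord-𝐞 {zero}  zero    = inverseˡ ε
  coord-𝐞 {suc m} zero    = inverseˡ ε
  coord-𝐞 {suc m} (suc j) = coord-𝐞 j

  coord-determined : ∀ k {g h : Vec Carrier m} → (∀ j → j ≢ k → coord g j ≡ coord h j) → g ≡ h
  coord-determined k {g} {h} = diffs-determined ε g h ε k

  coord-injective : ∀ {g h : Vec Carrier m} → (∀ j → coord g j ≡ coord h j) → g ≡ h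
  coord-injective eq = coord-determined zero λ j _ → eq j

  prescribe : ∀ (w : Fin (suc m) → Carrier) k → ∃ λ g → ∀ j → j ≢ k → coord g j ≡ w j
  prescribe w k = diffs-prescribed ε w ε k

  ∏-coord : ∀ (g : Vec Carrier m) → ∏ (diffs ε g ε) ≡ ε
  ∏-coord g = trans (∏-diffs ε g ε) (inverseˡ ε)

  _[_≔_] : (Fin m → Carrier) → Fin m → Carrier → Fin m → Carrier
  (w [ i ≔ x ]) j = if does (j Fin.≟ i) then x else w j

  ≔-updates : ∀ (w : Fin m → Carrier) i x → (w [ i ≔ x ]) i ≡ x
  ≔-updates w i x with i Fin.≟ i
  ... | yes _  = refl
  ... | no i≢i = contradiction refl i≢i

  ≔-minimal : ∀ (w : Fin m → Carrier) {i j} x → j ≢ i → (w [ i ≔ x ]) j ≡ w j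
  ≔-minimal w {i} {j} x j≢i with j Fin.≟ i
  ... | yes j≡i = contradiction j≡i j≢i
  ... | no _    = refl

  module _ {u v : Vec Carrier m} where

    -- Two vertices never differ in a single letter, since each letter is forced by the others; so
    -- the difference at `i` forces one at `k`.
    near-differ : ∀ {i k} → i ≢ k → coord u i ≢ coord v i →
      (∀ j → j ≢ i → j ≢ k → coord u j ≡ coord v j) → Differ i k u v
    near-differ {i} {k} i≢k ≢ᵢ eq = differ i≢k ≢ᵢ ≢ₖ eq
      where
      ≢ₖ : coord u k ≢ coord v k
      ≢ₖ eqₖ = ≢ᵢ (cong (λ g → coord g i) (coord-determined i {u} {v} agree))
        where
        agree : ∀ j → j ≢ i → coord u j ≡ coord v j
        agree j j≢i with j Fin.≟ k
        ... | yes refl = eqₖ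
        ... | no j≢k   = eq j j≢i j≢k

    near : ∀ {i k} → i ≢ k → (∀ j → j ≢ i → j ≢ k → coord u j ≡ coord v j) → u ≡ v ⊎ Differ i k u v
    near {i} {k} i≢k eq with coord u i ≟ coord v i
    ... | no ≢ᵢ  = inj₂ (near-differ i≢k ≢ᵢ eq)
    ... | yes eqᵢ = inj₁ (coord-determined k agree)
      where
      agree : ∀ j → j ≢ k → coord u j ≡ coord v j
      agree j j≢k with j Fin.≟ i
      ... | yes refl = eqᵢ
      ... | no j≢i   = eq j j≢i j≢k

    locate : ∀ {a b} → Differ a b u v → ∀ {i} → coord u i ≢ coord v i → i ≡ a ⊎ i ≡ b
    locate {a} {b} d {i} ≢ᵢ with i Fin.≟ a | i Fin.≟ b
    ... | yes i≡a | _       = inj₁ i≡a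
    ... | no _    | yes i≡b = inj₂ i≡b
    ... | no i≢a  | no i≢b  = contradiction (Differ.agree d i i≢a i≢b) ≢ᵢ

    -- Pigeonhole on the two positions of an edge. Non-adjacency is usually shown below by
    -- exhibiting three differing letters.
    no-three : u ∼ v → ∀ {i j k} → i ≢ j → i ≢ k → j ≢ k →
      coord u i ≢ coord v i → coord u j ≢ coord v j → coord u k ≢ coord v k → ⊥
    no-three (a , b , d) i≢j i≢k j≢k ≢ᵢ ≢ⱼ ≢ₖ with locate d ≢ᵢ | locate d ≢ⱼ | locate d ≢ₖ
    ... | inj₁ refl | inj₁ refl | _         = i≢j refl
    ... | inj₁ refl | inj₂ refl | inj₁ refl = i≢k refl
    ... | inj₁ refl | inj₂ refl | inj₂ refl = j≢k refl
    ... | inj₂ refl | inj₂ refl | _         = i≢j refl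
    ... | inj₂ refl | inj₁ refl | inj₂ refl = i≢k refl
    ... | inj₂ refl | inj₁ refl | inj₁ refl = j≢k refl

    differ-at : u ∼ v → ∀ {i j} → i ≢ j → coord u i ≢ coord v i → coord u j ≢ coord v j → Differ i j u v
    differ-at u∼v {i} {j} i≢j ≢ᵢ ≢ⱼ = differ i≢j ≢ᵢ ≢ⱼ λ k k≢i k≢j →
      decidable-stable (coord u k ≟ coord v k) λ ≢ₖ →
        no-three u∼v i≢j (≢-sym k≢i) (≢-sym k≢j) ≢ᵢ ≢ⱼ ≢ₖ

    differ-unique : ∀ {a b c d} → Differ a b u v → Differ c d u v → (a ≡ c × b ≡ d) ⊎ (a ≡ d × b ≡ c)
    differ-unique d₁ d₂ with locate d₂ (Differ.≢ˡ d₁) | locate d₂ (Differ.≢ʳ d₁)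
    ... | inj₁ refl | inj₂ refl = inj₁ (refl , refl)
    ... | inj₂ refl | inj₁ refl = inj₂ (refl , refl)
    ... | inj₁ refl | inj₁ refl = contradiction refl (Differ.distinct d₁)
    ... | inj₂ refl | inj₂ refl = contradiction refl (Differ.distinct d₁)

  -- The letter at `i` parametrizes the vertices over the pair `i`, `k` at `b`. Together with `b`
  -- they form a line: a clique with one vertex for each group element.
  extend : ∀ (b : Vec Carrier m) {i k} → i ≢ k → ∀ {x} → coord b i ≢ x →
    ∃ λ v → Differ i k b v × coord v i ≡ x
  extend b {i} {k} i≢k {x} bᵢ≢x with prescribe (coord b [ i ≔ x ]) k
  ... | v , eq = v , near-differ i≢k (λ bᵢ≡vᵢ → bᵢ≢x (trans bᵢ≡vᵢ vᵢ≡x))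
        (λ j j≢i j≢k → sym (trans (eq j j≢k) (≔-minimal (coord b) x j≢i))) , vᵢ≡x
    where
    vᵢ≡x : coord v i ≡ x
    vᵢ≡x = trans (eq i i≢k) (≔-updates (coord b) i x)

  -- Two pairs of positions coincide, share one element or are disjoint. The shared position is
  -- always written first, so later case splits need not treat swaps.
  data Position {m} (b v w : Vec Carrier m) : Set where
    same  : ∀ i k → Differ i k b v → Differ i k b w → Position b v w
    meet  : ∀ i k j → k ≢ j → Differ i k b v → Differ i j b w → Position b v w
    apart : ∀ i k j l → i ≢ j → i ≢ l → k ≢ j → k ≢ l → Differ i k b v → Differ j l b w → Position b v w

  module _ {b v w : Vec Carrier m} where

    position : ∀ {i k j l} → Differ i k b v → Differ j l b w → Position b v w
    position {i} {k} {j} {l} d e with i Fin.≟ j | i Fin.≟ l | k Fin.≟ j | k Fin.≟ l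
    ... | yes refl | _        | _        | yes refl = same i k d e
    ... | yes refl | _        | _        | no k≢l   = meet i k l k≢l d e
    ... | no i≢j   | yes refl | yes refl | _        = same i k d (differ-swap e)
    ... | no i≢j   | yes refl | no k≢j   | _        = meet i k j k≢j d (differ-swap e)
    ... | no i≢j   | no i≢l   | yes refl | _        = meet k i l i≢l (differ-swap d) e
    ... | no i≢j   | no i≢l   | no k≢j   | yes refl = meet k i j i≢j (differ-swap d) (differ-swap e)
    ... | no i≢j   | no i≢l   | no k≢j   | no k≢l   = apart i k j l i≢j i≢l k≢j k≢l d e

    module _ {i k} (d : Differ i k b v) where
      open Differ d using (agree; distinct)

      same-≡ : Differ i k b w → coord v i ≡ coord w i → v ≡ w
      same-≡ e eqᵢ = coord-determined k agree′
        where
        agree′ : ∀ j → j ≢ k → coord v j ≡ coord w j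
        agree′ j j≢k with j Fin.≟ i
        ... | yes refl = eqᵢ
        ... | no j≢i   = trans (sym (agree j j≢i j≢k)) (Differ.agree e j j≢i j≢k)

      same-differ : Differ i k b w → v ≡ w ⊎ Differ i k v w
      same-differ e = near distinct λ j j≢i j≢k →
        trans (sym (agree j j≢i j≢k)) (Differ.agree e j j≢i j≢k)

      -- `v` and `w` already differ at `k` and at `j`, which uses up both positions of an edge.
      meet-≡ : ∀ {j} → Differ i j b w → k ≢ j → v ∼ w → coord v i ≡ coord w i
      meet-≡ {j} e k≢j v∼w = decidable-stable (coord v i ≟ coord w i) λ ≢ᵢ →
        no-three v∼w distinct (Differ.distinct e) k≢j ≢ᵢ
          (λ eq → Differ.≢ʳ d (trans (Differ.agree e k (≢-sym distinct) k≢j) (sym eq)))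
          (λ eq → Differ.≢ʳ e (trans (agree j (≢-sym (Differ.distinct e)) (≢-sym k≢j)) eq))

      meet-differ : ∀ {j} → Differ i j b w → k ≢ j → coord v i ≡ coord w i → Differ k j v w
      meet-differ {j} e k≢j eqᵢ = near-differ k≢j
        (λ eq → Differ.≢ʳ d (trans (Differ.agree e k (≢-sym distinct) k≢j) (sym eq))) agree′
        where
        agree′ : ∀ l → l ≢ k → l ≢ j → coord v l ≡ coord w l
        agree′ l l≢k l≢j with l Fin.≟ i
        ... | yes refl = eqᵢ
        ... | no l≢i   = trans (sym (agree l l≢i l≢k)) (Differ.agree e l l≢i l≢j)

      apart-≁ : ∀ {j l} → Differ j l b w → i ≢ j → i ≢ l → k ≢ j → k ≢ l → ¬ v ∼ w
      apart-≁ {j} {l} e i≢j i≢l k≢j k≢l v∼w = no-three v∼w distinct i≢j k≢j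
        (λ eq → Differ.≢ˡ d (trans (Differ.agree e i i≢j i≢l) (sym eq)))
        (λ eq → Differ.≢ʳ d (trans (Differ.agree e k k≢j k≢l) (sym eq)))
        (λ eq → Differ.≢ˡ e (trans (agree j (≢-sym i≢j) (≢-sym k≢j)) eq))

    differ-transfer : ∀ {i k α β} → Differ i k b v → Differ i k b w → Differ α β b v → Differ α β b w
    differ-transfer d e d′ with differ-unique d d′
    ... | inj₁ (refl , refl) = e
    ... | inj₂ (refl , refl) = differ-swap e

-- Automorphisms map lines into lines.

module LinePreservation (G : FinGroup) (nonAbelian : Cay.NonAbelian G) where

  open FinGroup G
  open Adjacency G
  open Lines G nonAbelian

  private variable
    m : ℕ

  -- Common neighbours near `b` are excluded because they blur the count: for disjoint pairs these
  -- are `b` itself and possibly vertices that mix one letter of `v` with one of `z`. Away from `b`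
  -- at most one common neighbour is left in that case.
  record FarNeighbour {m} (b v z u : Vec Carrier m) : Set where
    constructor far
    field
      fromˡ : v ∼ u
      fromʳ : z ∼ u
      ≁base : ¬ b ∼ u
      ≢base : b ≢ u

  -- For neighbours v, z of b this says that the supports of v and z relative to b meet in one position.
  Linked : Vec Carrier m → Vec Carrier m → Vec Carrier m → Set
  Linked b v z = v ∼ z ⊎ ∃₂ λ q r → q ≢ r × FarNeighbour b v z q × FarNeighbour b v z r

  module _ {b v z : Vec Carrier m} where

    private
      -- If `u` keeps the letter of `v` at `i` but not those at `k` and `j`, the edge from `v` to
      -- `u` lies over `k`, `j` and the edge from `z` over `i`, `l`; so `u` can differ from `b` only
      -- at `i` and `j`.
      mixed : ∀ {i k j l} → Differ i k b v → Differ j l b z → i ≢ j → i ≢ l → k ≢ j → k ≢ l →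
        ∀ {u} → v ∼ u → z ∼ u → coord v i ≡ coord u i → coord v k ≢ coord u k → coord v j ≢ coord u j →
        b ≡ u ⊎ b ∼ u
      mixed {i} {k} {j} {l} d e i≢j i≢l k≢j k≢l {u} v∼u z∼u eqᵢ ≢ₖ ≢ⱼ =
        Sum.map₂ (λ f → _ , _ , f) (near i≢j agree)
        where
        v-u = differ-at v∼u k≢j ≢ₖ ≢ⱼ
        eqₗ = Differ.agree v-u l (≢-sym k≢l) (≢-sym (Differ.distinct e))
        z-u = differ-at z∼u i≢l
          (λ zᵢ≡uᵢ → Differ.≢ˡ d (trans (Differ.agree e i i≢j i≢l) (trans zᵢ≡uᵢ (sym eqᵢ))))
          (λ zₗ≡uₗ → Differ.≢ʳ e (trans (Differ.agree d l (≢-sym i≢l) (≢-sym k≢l)) (trans eqₗ (sym zₗ≡uₗ))))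
        agree : ∀ p → p ≢ i → p ≢ j → coord b p ≡ coord u p
        agree p p≢i p≢j with p Fin.≟ k
        ... | yes refl = trans (Differ.agree e k k≢j k≢l) (Differ.agree z-u k p≢i k≢l)
        ... | no p≢k   = trans (Differ.agree d p p≢i p≢k) (Differ.agree v-u p p≢k p≢j)

    -- Split on which letters of `v` the far neighbour keeps. Only keeping both `i` and `k`
    -- survives; then `u` carries the change made by `v` on top of `z`, which determines it.
    far-differ : ∀ {i k j l} → Differ i k b v → Differ j l b z → i ≢ j → i ≢ l → k ≢ j → k ≢ l →
      ∀ {u} → FarNeighbour b v z u → Differ i k z u × coord v i ≡ coord u i
    far-differ {i} {k} {j} {l} d e i≢j i≢l k≢j k≢l {u} (far v∼u z∼u b≁u b≢u)
      with coord v i ≟ coord u i | coord v k ≟ coord u k | coord v j ≟ coord u j | coord v l ≟ coord u l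
    ... | yes eqᵢ | yes eqₖ | _ | _ = differ-at z∼u (Differ.distinct d)
            (λ zᵢ≡uᵢ → Differ.≢ˡ d (trans (Differ.agree e i i≢j i≢l) (trans zᵢ≡uᵢ (sym eqᵢ))))
            (λ zₖ≡uₖ → Differ.≢ʳ d (trans (Differ.agree e k k≢j k≢l) (trans zₖ≡uₖ (sym eqₖ)))) , eqᵢ
    ... | no ≢ᵢ | no ≢ₖ | _ | _ = ⊥-elim ([ b≢u , (λ f → b≁u (_ , _ , f)) ]′ (near (Differ.distinct d)
            λ p p≢i p≢k → trans (Differ.agree d p p≢i p≢k)
              (Differ.agree (differ-at v∼u (Differ.distinct d) ≢ᵢ ≢ₖ) p p≢i p≢k)))
    ... | yes eqᵢ | no ≢ₖ | no ≢ⱼ | _ =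
            ⊥-elim ([ b≢u , b≁u ]′ (mixed d e i≢j i≢l k≢j k≢l v∼u z∼u eqᵢ ≢ₖ ≢ⱼ))
    ... | yes eqᵢ | no ≢ₖ | yes _ | no ≢ₗ =
            ⊥-elim ([ b≢u , b≁u ]′ (mixed d (differ-swap e) i≢l i≢j k≢l k≢j v∼u z∼u eqᵢ ≢ₖ ≢ₗ))
    ... | no ≢ᵢ | yes eqₖ | no ≢ⱼ | _ =
            ⊥-elim ([ b≢u , b≁u ]′ (mixed (differ-swap d) e k≢j k≢l i≢j i≢l v∼u z∼u eqₖ ≢ᵢ ≢ⱼ))
    ... | no ≢ᵢ | yes eqₖ | yes _ | no ≢ₗ =
            ⊥-elim ([ b≢u , b≁u ]′ (mixed (differ-swap d) (differ-swap e) k≢l k≢j i≢l i≢j v∼u z∼u eqₖ ≢ᵢ ≢ₗ))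
    ... | yes eqᵢ | no _ | yes eqⱼ | yes eqₗ = ⊥-elim (no-three z∼u i≢j i≢l (Differ.distinct e)
            (λ zᵢ≡uᵢ → Differ.≢ˡ d (trans (Differ.agree e i i≢j i≢l) (trans zᵢ≡uᵢ (sym eqᵢ))))
            (λ zⱼ≡uⱼ → Differ.≢ˡ e (trans (Differ.agree d j (≢-sym i≢j) (≢-sym k≢j)) (trans eqⱼ (sym zⱼ≡uⱼ))))
            (λ zₗ≡uₗ → Differ.≢ʳ e (trans (Differ.agree d l (≢-sym i≢l) (≢-sym k≢l)) (trans eqₗ (sym zₗ≡uₗ)))))
    ... | no _ | yes eqₖ | yes eqⱼ | yes eqₗ = ⊥-elim (no-three z∼u k≢j k≢l (Differ.distinct e)
            (λ zₖ≡uₖ → Differ.≢ʳ d (trans (Differ.agree e k k≢j k≢l) (trans zₖ≡uₖ (sym eqₖ))))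
            (λ zⱼ≡uⱼ → Differ.≢ˡ e (trans (Differ.agree d j (≢-sym i≢j) (≢-sym k≢j)) (trans eqⱼ (sym zⱼ≡uⱼ))))
            (λ zₗ≡uₗ → Differ.≢ʳ e (trans (Differ.agree d l (≢-sym i≢l) (≢-sym k≢l)) (trans eqₗ (sym zₗ≡uₗ)))))

    apart-¬linked : ∀ {i k j l} → Differ i k b v → Differ j l b z → i ≢ j → i ≢ l → k ≢ j → k ≢ l →
      ¬ Linked b v z
    apart-¬linked d e i≢j i≢l k≢j k≢l (inj₁ v∼z) = apart-≁ d e i≢j i≢l k≢j k≢l v∼z
    apart-¬linked d e i≢j i≢l k≢j k≢l (inj₂ (q , r , q≢r , q-far , r-far))
      with far-differ d e i≢j i≢l k≢j k≢l q-far | far-differ d e i≢j i≢l k≢j k≢l r-far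
    ... | z-q , vᵢ≡qᵢ | z-r , vᵢ≡rᵢ = q≢r (same-≡ z-q z-r (trans (sym vᵢ≡qᵢ) vᵢ≡rᵢ))

  -- `q` has the letter of `z` at `i`, the letter of `v` at `k` and a correction at `j`. It differs
  -- from `b` in all three positions, hence is far.
  meet-far : ∀ {b v z : Vec Carrier m} {i k j} → k ≢ j → Differ i k b v → Differ i j b z →
    coord v i ≢ coord z i → ∃ λ q → FarNeighbour b v z q × coord q i ≡ coord z i
  meet-far {b = b} {v} {z} {i} {k} {j} k≢j d e vᵢ≢zᵢ with prescribe (coord v [ i ≔ coord z i ]) j
  ... | q , eq = q , far (_ , _ , v-q) (_ , _ , z-q) b≁q (λ b≡q → b≢qᵢ (cong (λ g → coord g i) b≡q)) , qᵢ≡zᵢ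
    where
    i≢k = Differ.distinct d
    i≢j = Differ.distinct e
    qᵢ≡zᵢ : coord q i ≡ coord z i
    qᵢ≡zᵢ = trans (eq i i≢j) (≔-updates (coord v) i (coord z i))
    v≡q : ∀ p → p ≢ i → p ≢ j → coord v p ≡ coord q p
    v≡q p p≢i p≢j = sym (trans (eq p p≢j) (≔-minimal (coord v) (coord z i) p≢i))
    v-q : Differ i j v q
    v-q = near-differ i≢j (λ vᵢ≡qᵢ → vᵢ≢zᵢ (trans vᵢ≡qᵢ qᵢ≡zᵢ)) v≡q
    agree : ∀ p → p ≢ k → p ≢ j → coord z p ≡ coord q p
    agree p p≢k p≢j with p Fin.≟ i
    ... | yes refl = sym qᵢ≡zᵢ
    ... | no p≢i   = trans (sym (Differ.agree e p p≢i p≢j)) (trans (Differ.agree d p p≢i p≢k) (v≡q p p≢i p≢j))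
    vₖ≡qₖ = v≡q k (≢-sym i≢k) k≢j
    z-q : Differ k j z q
    z-q = near-differ k≢j (λ zₖ≡qₖ → Differ.≢ʳ d
      (trans (Differ.agree e k (≢-sym i≢k) k≢j) (trans zₖ≡qₖ (sym vₖ≡qₖ)))) agree
    b≢qᵢ : coord b i ≢ coord q i
    b≢qᵢ bᵢ≡qᵢ = Differ.≢ˡ e (trans bᵢ≡qᵢ qᵢ≡zᵢ)
    b≁q : ¬ b ∼ q
    b≁q b∼q = no-three b∼q i≢k i≢j k≢j b≢qᵢ
      (λ bₖ≡qₖ → Differ.≢ʳ d (trans bₖ≡qₖ (sym vₖ≡qₖ)))
      (λ bⱼ≡qⱼ → Differ.≢ʳ v-q (trans (sym (Differ.agree d j (≢-sym i≢j) (≢-sym k≢j))) bⱼ≡qⱼ))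

  -- Exchanging `v` and `z` in `meet-far` yields the second far neighbour, told apart from the first
  -- by its letter at `i`.
  meet-linked : ∀ {b v z : Vec Carrier m} {i k j} → k ≢ j → Differ i k b v → Differ i j b z → Linked b v z
  meet-linked {v = v} {z} {i} {k} {j} k≢j d e with coord v i ≟ coord z i
  ... | yes vᵢ≡zᵢ = inj₁ (_ , _ , meet-differ d e k≢j vᵢ≡zᵢ)
  ... | no vᵢ≢zᵢ
    with meet-far k≢j d e vᵢ≢zᵢ | meet-far (≢-sym k≢j) e d (≢-sym vᵢ≢zᵢ)
  ...   | q , q-far , qᵢ≡zᵢ | r , far z∼r v∼r b≁r b≢r , rᵢ≡vᵢ = inj₂ (q , r ,
            (λ q≡r → vᵢ≢zᵢ (trans (sym rᵢ≡vᵢ) (trans (cong (λ g → coord g i) (sym q≡r)) qᵢ≡zᵢ))) ,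
            q-far , far v∼r z∼r b≁r b≢r)

  record Automorphism (m : ℕ) : Set where
    field
      to         : Vec Carrier m → Vec Carrier m
      injective  : ∀ {u v} → to u ≡ to v → u ≡ v
      surjective : ∀ v → ∃ λ u → to u ≡ v
      preserve   : ∀ {u v} → u ∼ v → to u ∼ to v
      reflect    : ∀ {u v} → to u ∼ to v → u ∼ v

  module _ (φ : Automorphism m) where
    open Automorphism φ

    far-preserve : ∀ {b v z u} → FarNeighbour b v z u → FarNeighbour (to b) (to v) (to z) (to u)
    far-preserve (far v∼u z∼u b≁u b≢u) = far (preserve v∼u) (preserve z∼u) (b≁u ∘ reflect) (b≢u ∘ injective)

    far-reflect : ∀ {b v z u} → FarNeighbour (to b) (to v) (to z) (to u) → FarNeighbour b v z u
    far-reflect (far v∼u z∼u b≁u b≢u) = far (reflect v∼u) (reflect z∼u) (b≁u ∘ preserve) (b≢u ∘ cong to)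

    linked-preserve : ∀ {b v z} → Linked b v z → Linked (to b) (to v) (to z)
    linked-preserve (inj₁ v∼z) = inj₁ (preserve v∼z)
    linked-preserve (inj₂ (q , r , q≢r , q-far , r-far)) =
      inj₂ (to q , to r , q≢r ∘ injective , far-preserve q-far , far-preserve r-far)

    linked-reflect : ∀ {b v z} → Linked (to b) (to v) (to z) → Linked b v z
    linked-reflect (inj₁ v∼z) = inj₁ (reflect v∼z)
    linked-reflect (inj₂ (q , r , q≢r , q-far , r-far)) with surjective q | surjective r
    ... | q , refl | r , refl = inj₂ (q , r , q≢r ∘ cong to , far-reflect q-far , far-reflect r-far)

    private
      -- A line through b has at least five points, whereas only one further vertex is
      -- adjacent to b and to two neighbours of b on different lines when there are three positions.
      ¬meet-three : ∀ {b v w i k α β γ} → Differ i k b v → Differ i k b w → v ≢ w → β ≢ γ →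
        Differ α β (to b) (to v) → Differ α γ (to b) (to w) →
        (∀ p → p ≡ α ⊎ p ≡ β ⊎ p ≡ γ) → ⊥
      ¬meet-three {b} {v} {w} {i} {k} {α} {β} {γ} d e v≢w β≢γ d′ e′ cover
        with avoid (coord b i) (coord v i) (coord w i)
      ... | x , y , x≢y , (b≢x , v≢x , w≢x) , (b≢y , v≢y , w≢y)
        with extend b (Differ.distinct d) b≢x | extend b (Differ.distinct d) b≢y
      ... | p , b-p , pᵢ≡x | q , b-q , qᵢ≡y = x≢y (trans (sym pᵢ≡x) (trans (cong (λ g → coord g i) p≡q) qᵢ≡y))
        where
        v∼w : v ∼ w
        v∼w with same-differ d e
        ... | inj₁ v≡w = contradiction v≡w v≢w
        ... | inj₂ v-w = _ , _ , v-w
        v′≡w′ : coord (to v) α ≡ coord (to w) α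
        v′≡w′ = meet-≡ d′ e′ β≢γ (preserve v∼w)
        module _ {p} (b-p : Differ i k b p) (v≢p : v ≢ p) (w≢p : w ≢ p) where
          v′∼p′ : to v ∼ to p
          v′∼p′ with same-differ d b-p
          ... | inj₁ v≡p = contradiction v≡p v≢p
          ... | inj₂ v-p = preserve (_ , _ , v-p)
          w′∼p′ : to w ∼ to p
          w′∼p′ with same-differ e b-p
          ... | inj₁ w≡p = contradiction w≡p w≢p
          ... | inj₂ w-p = preserve (_ , _ , w-p)
          ¬αβ : ¬ Differ α β (to b) (to p)
          ¬αβ f = v≢p (injective (same-≡ d′ f (trans v′≡w′ (meet-≡ e′ f (≢-sym β≢γ) w′∼p′))))
          ¬αγ : ¬ Differ α γ (to b) (to p)
          ¬αγ f = w≢p (injective (same-≡ e′ f (trans (sym v′≡w′) (meet-≡ d′ f β≢γ v′∼p′))))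
          third-line : Differ β γ (to b) (to p)
          third-line with preserve (_ , _ , b-p)
          ... | s , t , f with cover s | cover t
          ...   | inj₁ refl        | inj₁ refl        = contradiction refl (Differ.distinct f)
          ...   | inj₁ refl        | inj₂ (inj₁ refl) = contradiction f ¬αβ
          ...   | inj₁ refl        | inj₂ (inj₂ refl) = contradiction f ¬αγ
          ...   | inj₂ (inj₁ refl) | inj₁ refl        = contradiction (differ-swap f) ¬αβ
          ...   | inj₂ (inj₁ refl) | inj₂ (inj₁ refl) = contradiction refl (Differ.distinct f)
          ...   | inj₂ (inj₁ refl) | inj₂ (inj₂ refl) = f
          ...   | inj₂ (inj₂ refl) | inj₁ refl        = contradiction (differ-swap f) ¬αγ
          ...   | inj₂ (inj₂ refl) | inj₂ (inj₁ refl) = differ-swap f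
          ...   | inj₂ (inj₂ refl) | inj₂ (inj₂ refl) = contradiction refl (Differ.distinct f)
          third-value : coord (to v) β ≡ coord (to p) β
          third-value = meet-≡ (differ-swap d′) third-line
            (λ α≡γ → Differ.distinct e′ α≡γ) v′∼p′
        separated : ∀ {u p x} → coord p i ≡ x → coord u i ≢ x → u ≢ p
        separated pᵢ≡x uᵢ≢x refl = uᵢ≢x pᵢ≡x
        p≡q : p ≡ q
        p≡q = injective (same-≡
          (third-line b-p (separated pᵢ≡x v≢x) (separated pᵢ≡x w≢x))
          (third-line b-q (separated qᵢ≡y v≢y) (separated qᵢ≡y w≢y))
          (trans (sym (third-value b-p (separated pᵢ≡x v≢x) (separated pᵢ≡x w≢x)))
                 (third-value b-q (separated qᵢ≡y v≢y) (separated qᵢ≡y w≢y))))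

      -- Choose `z` with image over `γ`, `δ`: this image is linked to that of `w` but not to that of
      -- `v`. Yet `v` and `w` lie over one pair at `b`, so a pair for `z` that meets it links `z` to
      -- `v`, and a pair disjoint from it separates `z` from `w`. If `z` lies over that very pair,
      -- it equals `v` or is adjacent to it.
      ¬meet-fourth : ∀ {b v w i k α β γ δ} → Differ i k b v → Differ i k b w → β ≢ γ →
        Differ α β (to b) (to v) → Differ α γ (to b) (to w) → δ ≢ α → δ ≢ β → δ ≢ γ → ⊥
      ¬meet-fourth {b} {v} {w} {i} {k} {α} {β} {γ} {δ} d e β≢γ d′ e′ δ≢α δ≢β δ≢γ
        with extend (to b) {γ} {δ} (≢-sym δ≢γ) (Differ.≢ʳ e′)
      ... | z′ , b′-z′ , z′ᵧ≡ with surjective z′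
      ... | z , refl = helper (reflect (_ , _ , b′-z′))
        where
        α≢γ = Differ.distinct e′
        ¬linked : ¬ Linked b v z
        ¬linked = apart-¬linked d′ b′-z′ α≢γ (≢-sym δ≢α) β≢γ (≢-sym δ≢β) ∘ linked-preserve
        linked : Linked b w z
        linked = linked-reflect (meet-linked (≢-sym δ≢α) (differ-swap e′) b′-z′)
        helper : b ∼ z → ⊥
        helper (_ , _ , f) with position d f
        ... | same _ _ d₁ f₁ with same-differ d₁ f₁
        ...   | inj₁ refl = Differ.≢ˡ b′-z′ (Differ.agree d′ γ (≢-sym α≢γ) (≢-sym β≢γ))
        ...   | inj₂ v-z  = ¬linked (inj₁ (_ , _ , v-z))
        helper (_ , _ , f) | meet _ _ _ k≢j d₁ f₁ = ¬linked (meet-linked k≢j d₁ f₁)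
        helper (_ , _ , f) | apart _ _ _ _ ≢₁ ≢₂ ≢₃ ≢₄ d₁ f₁ =
          apart-¬linked (differ-transfer d e d₁) f₁ ≢₁ ≢₂ ≢₃ ≢₄ linked

    line-preserve : ∀ {b v w i k α β} → Differ i k b v → Differ i k b w →
      Differ α β (to b) (to v) → Differ α β (to b) (to w)
    line-preserve {b} {v} {w} d e d′ with same-differ d e
    ... | inj₁ refl = d′
    ... | inj₂ v-w with preserve {v} {w} (_ , _ , v-w) | preserve {b} {w} (_ , _ , e)
    ...   | v′∼w′ | _ , _ , e′ with position d′ e′
    ...     | same _ _ d″ e″ = differ-transfer d″ e″ d′
    ...     | apart _ _ _ _ ≢₁ ≢₂ ≢₃ ≢₄ d″ e″ = contradiction v′∼w′ (apart-≁ d″ e″ ≢₁ ≢₂ ≢₃ ≢₄)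
    ...     | meet α β γ β≢γ d″ e″
      -- A disjoint pair needs a fourth position; when there are only three, counting the points of
      -- a line takes over.
      with Fin.any? (λ δ → ¬? (δ Fin.≟ α) ×-dec ¬? (δ Fin.≟ β) ×-dec ¬? (δ Fin.≟ γ))
    ...       | yes (δ , δ≢α , δ≢β , δ≢γ) = ⊥-elim (¬meet-fourth d e β≢γ d″ e″ δ≢α δ≢β δ≢γ)
    ...       | no ¬fourth = ⊥-elim (¬meet-three d e v≢w β≢γ d″ e″ cover)
      where
      v≢w : v ≢ w
      v≢w refl = Differ.≢ˡ v-w refl
      cover : ∀ p → p ≡ α ⊎ p ≡ β ⊎ p ≡ γ
      cover p with p Fin.≟ α | p Fin.≟ β | p Fin.≟ γ
      ... | yes p≡α | _       | _       = inj₁ p≡α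
      ... | no _    | yes p≡β | _       = inj₂ (inj₁ p≡β)
      ... | no _    | no _    | yes p≡γ = inj₂ (inj₂ p≡γ)
      ... | no p≢α  | no p≢β  | no p≢γ  = contradiction (p , p≢α , p≢β , p≢γ) ¬fourth

    inverse : Automorphism m
    inverse = record
      { to         = from
      ; injective  = λ {u} {v} eq → trans (sym (to-from u)) (trans (cong to eq) (to-from v))
      ; surjective = λ v → to v , injective (to-from (to v))
      ; preserve   = λ {u} {v} u∼v → reflect (subst₂ _∼_ (sym (to-from u)) (sym (to-from v)) u∼v)
      ; reflect    = λ {u} {v} u∼v → subst₂ _∼_ (to-from u) (to-from v) (preserve u∼v)
      }
      where
      from : Vec Carrier m → Vec Carrier m
      from v = proj₁ (surjective v)
      to-from : ∀ v → to (from v) ≡ v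
      to-from v = proj₂ (surjective v)

  module _ (φ : Automorphism m) where
    open Automorphism φ

    line-reflect : ∀ {b v w i k α β} →
      Differ α β (to b) (to v) → Differ α β (to b) (to w) → Differ i k b v → Differ i k b w
    line-reflect {b} {v} {w} d′ e′ d = subst₂ (Differ _ _) (from-to b) (from-to w)
      (line-preserve (inverse φ) d′ e′ (subst₂ (Differ _ _) (sym (from-to b)) (sym (from-to v)) d))
      where
      from-to : ∀ u → proj₁ (surjective (to u)) ≡ u
      from-to u = injective (proj₂ (surjective (to u)))

-- From a map on pairs to a map on positions, at one vertex.

module Places (G : FinGroup) (nonAbelian : Cay.NonAbelian G) where

  open FinGroup G
  open Differences G
  open Adjacency G
  open Lines G nonAbelian
  open LinePreservation G nonAbelian

  private variable
    m : ℕ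

  _·_ : Vec Carrier m → Vec Carrier m → Vec Carrier m
  _·_ = zipWith _∙_

  ·-cancelʳ : ∀ (u g : Vec Carrier m) → (u · g) · map _⁻¹ g ≡ u
  ·-cancelʳ u g = trans (Vec.zipWith-assoc assoc u g _)
    (trans (cong (u ·_) (Vec.zipWith-inverseʳ inverseʳ g)) (Vec.zipWith-identityʳ identityʳ u))

  coord-translate : ∀ (u v g : Vec Carrier m) j → coord u j ≡ coord v j → coord (u · g) j ≡ coord (v · g) j
  coord-translate u v g j eq =
    subst (λ e → lookup (diffs e (u · g) e) j ≡ lookup (diffs e (v · g) e) j) (identityˡ ε)
      (diffs-translate ε ε u v g ε ε ε j eq)

  coord-translate⁻¹ : ∀ (u v g : Vec Carrier m) j → coord (u · g) j ≡ coord (v · g) j → coord u j ≡ coord v j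
  coord-translate⁻¹ u v g j eq = subst₂ (λ u v → coord u j ≡ coord v j) (·-cancelʳ u g) (·-cancelʳ v g)
    (coord-translate (u · g) (v · g) (map _⁻¹ g) j eq)

  differ-translate : ∀ {i k} {u v : Vec Carrier m} g → Differ i k u v → Differ i k (u · g) (v · g)
  differ-translate {i = i} {k} {u} {v} g (differ i≢k ≢ᵢ ≢ₖ eq) = differ i≢k
    (≢ᵢ ∘ coord-translate⁻¹ u v g i) (≢ₖ ∘ coord-translate⁻¹ u v g k)
    (λ j j≢i j≢k → coord-translate u v g j (eq j j≢i j≢k))

  differ-translate⁻¹ : ∀ {i k} {u v : Vec Carrier m} g → Differ i k (u · g) (v · g) → Differ i k u v
  differ-translate⁻¹ {u = u} {v} g d =
    subst₂ (Differ _ _) (·-cancelʳ u g) (·-cancelʳ v g) (differ-translate (map _⁻¹ g) d)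

  support₂ : ∀ (v : Vec Carrier m) {i k} → i ≢ k → (∀ j → j ≢ i → j ≢ k → coord v j ≡ ε) →
    coord v k ≡ coord v i ⁻¹
  support₂ v {i} {k} i≢k eq with Fin.<-cmp i k
  ... | tri< i<k _ _ = inverseʳ-unique _ _
          (trans (sym (∏-support₂ (diffs ε v ε) i<k eq)) (∏-coord v))
  ... | tri≈ _ i≡k _ = contradiction i≡k i≢k
  ... | tri> _ _ k<i = inverseˡ-unique _ _
          (trans (sym (∏-support₂ (diffs ε v ε) k<i λ j j≢k j≢i → eq j j≢i j≢k)) (∏-coord v))

  differ-𝐞 : ∀ {i k} {v : Vec Carrier m} → Differ i k (replicate m ε) v → coord v k ≡ coord v i ⁻¹
  differ-𝐞 {v = v} d = support₂ v (Differ.distinct d) λ j j≢i j≢k →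
    trans (sym (Differ.agree d j j≢i j≢k)) (coord-𝐞 j)

  -- At 𝐞 take v, w with the value x ≢ x⁻¹ at i: then z has x at k while w has x⁻¹ there.
  opaque
    open-triangle : ∀ (b : Vec Carrier m) {i j k} → i ≢ j → i ≢ k → j ≢ k → ∃ λ v → ∃₂ λ w z →
      Differ i j b v × Differ i k b w × Differ j k b z × v ∼ w × v ∼ z × ¬ w ∼ z
    open-triangle {m} b {i} {j} {k} i≢j i≢k j≢k = from-𝐞
      where
      𝐞 : Vec Carrier m
      𝐞 = replicate m ε
      x : Carrier
      x = proj₁ nonInvolution
      x≢x⁻¹ : x ≢ x ⁻¹
      x≢x⁻¹ = proj₂ nonInvolution
      ε≢x : coord 𝐞 i ≢ x
      ε≢x eq = x≢x⁻¹ (trans (sym ε≡x) (trans (sym ε⁻¹≈ε) (cong _⁻¹ ε≡x)))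
        where
        ε≡x : ε ≡ x
        ε≡x = trans (sym (coord-𝐞 i)) eq
      from-𝐞 : ∃ λ v → ∃₂ λ w z →
        Differ i j b v × Differ i k b w × Differ j k b z × v ∼ w × v ∼ z × ¬ w ∼ z
      from-𝐞 with extend 𝐞 i≢j ε≢x | extend 𝐞 i≢k ε≢x
      ... | v , 𝐞-v , vᵢ≡x | w , 𝐞-w , wᵢ≡x with extend 𝐞 j≢k (Differ.≢ʳ 𝐞-v)
      ...   | z , 𝐞-z , zⱼ≡vⱼ = v · b , w · b , z · b , move 𝐞-v , move 𝐞-w , move 𝐞-z ,
              (_ , _ , differ-translate b (meet-differ 𝐞-v 𝐞-w j≢k (trans vᵢ≡x (sym wᵢ≡x)))) ,
              (_ , _ , differ-translate b (meet-differ (differ-swap 𝐞-v) 𝐞-z i≢k (sym zⱼ≡vⱼ))) ,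
              λ { (_ , _ , d) → w≁z (_ , _ , differ-translate⁻¹ b d) }
        where
        move : ∀ {i k u} → Differ i k 𝐞 u → Differ i k b (u · b)
        move {i} {k} {u} d = subst (λ e → Differ i k e (u · b)) (Vec.zipWith-identityˡ identityˡ b) (differ-translate b d)
        zₖ≡x : coord z k ≡ x
        zₖ≡x = trans (differ-𝐞 𝐞-z) (trans (cong _⁻¹ (trans zⱼ≡vⱼ (differ-𝐞 𝐞-v)))
          (trans (⁻¹-involutive _) vᵢ≡x))
        wₖ≡x⁻¹ : coord w k ≡ x ⁻¹
        wₖ≡x⁻¹ = trans (differ-𝐞 𝐞-w) (cong _⁻¹ wᵢ≡x)
        w≁z : ¬ w ∼ z
        w≁z w∼z = x≢x⁻¹ (trans (sym zₖ≡x) (trans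
          (sym (meet-≡ (differ-swap 𝐞-w) (differ-swap 𝐞-z) i≢j w∼z)) wₖ≡x⁻¹))

  opaque
    line : ∀ (b : Vec Carrier m) {i k} → i ≢ k → ∃ λ v → Differ i k b v
    line b {i} i≢k with avoid (coord b i) (coord b i) (coord b i)
    ... | x , _ , _ , (bᵢ≢x , _) , _ with extend b i≢k bᵢ≢x
    ...   | v , d , _ = v , d

  -- The main form in which `1 < m` is used: a spare position to absorb the correction in a word or
  -- to complete a triple.
  third : ∀ (i k : Fin (3 ℕ.+ m)) → ∃ λ j → i ≢ j × k ≢ j
  third zero           zero           = suc zero , (λ ()) , (λ ())
  third zero           (suc zero)     = suc (suc zero) , (λ ()) , (λ ())
  third zero           (suc (suc _))  = suc zero , (λ ()) , (λ ())
  third (suc zero)     zero           = suc (suc zero) , (λ ()) , (λ ())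
  third (suc (suc _))  zero           = suc zero , (λ ()) , (λ ())
  third (suc _)        (suc _)        = zero , (λ ()) , (λ ())

  module _ (φ : Automorphism (2 ℕ.+ m)) (b : Vec Carrier (2 ℕ.+ m)) where
    open Automorphism φ

    -- Both pairs are unordered in effect, so `α` and `β` are known only up to the swap in
    -- `maps-unique`; telling them apart is the task of `star`.
    Maps : (i k α β : Fin (3 ℕ.+ m)) → Set
    Maps i k α β = ∀ {v} → Differ i k b v → Differ α β (to b) (to v)

    private variable
      i j k α β γ δ : Fin (3 ℕ.+ m)

    maps-swapˡ : Maps i k α β → Maps k i α β
    maps-swapˡ f d = f (differ-swap d)

    maps-≢ : i ≢ k → Maps i k α β → α ≢ β
    maps-≢ i≢k f = Differ.distinct (f (proj₂ (line b i≢k)))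

    maps-reflect : i ≢ k → Maps i k α β → ∀ {v} → Differ α β (to b) (to v) → Differ i k b v
    maps-reflect i≢k f {v} d = line-reflect φ (f d₀) d d₀
      where d₀ = proj₂ (line b i≢k)

    maps-unique : i ≢ k → Maps i k α β → Maps i k γ δ → (α ≡ γ × β ≡ δ) ⊎ (α ≡ δ × β ≡ γ)
    maps-unique i≢k f g = differ-unique (f d₀) (g d₀)
      where d₀ = proj₂ (line b i≢k)

    maps-injective : i ≢ k → i ≢ j → k ≢ j → Maps i k α β → ¬ Maps i j α β
    maps-injective i≢k i≢j k≢j f g with line b i≢j
    ... | w , d with differ-unique d (maps-reflect i≢k f (g d))
    ...   | inj₁ (_ , j≡k)     = k≢j (sym j≡k)
    ...   | inj₂ (i≡k , _)     = i≢k i≡k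

    opaque
      -- Take `v` and `w` with the same letter at `i`. They are adjacent, so the image pairs are not
      -- disjoint, and `maps-injective` keeps the pairs from coinciding.
      maps-meet : i ≢ k → i ≢ j → k ≢ j → ∃ λ α → ∃₂ λ β γ → β ≢ γ × Maps i k α β × Maps i j α γ
      maps-meet {i} {k} {j} i≢k i≢j k≢j with line b i≢k
      ... | v , d with extend b i≢j (Differ.≢ˡ d)
      ...   | w , e , wᵢ≡vᵢ
        with preserve {b} {v} (_ , _ , d) | preserve {b} {w} (_ , _ , e)
           | preserve {v} {w} (_ , _ , meet-differ d e k≢j (sym wᵢ≡vᵢ))
      ...     | _ , _ , d′ | _ , _ , e′ | v′∼w′ with position d′ e′
      ...       | same _ _ d″ e″ = ⊥-elim (maps-injective i≢k i≢j k≢j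
                    (λ f → line-preserve φ d f d″) (λ f → line-preserve φ e f e″))
      ...       | apart _ _ _ _ ≢₁ ≢₂ ≢₃ ≢₄ d″ e″ = contradiction v′∼w′ (apart-≁ d″ e″ ≢₁ ≢₂ ≢₃ ≢₄)
      ...       | meet α β γ β≢γ d″ e″ = α , β , γ , β≢γ ,
                    (λ f → line-preserve φ d f d″) , (λ f → line-preserve φ e f e″)

    private
      -- Over different pairs through `i`, adjacency means equal letters at `i`, so two neighbours
      -- of a third vertex are adjacent to each other. Over the three pairs in a triple
      -- `open-triangle` violates this.
      ¬star↦triangle : ∀ {i k₀ k₁ k α β γ} → i ≢ k₀ → i ≢ k₁ → i ≢ k → k₀ ≢ k₁ → k₀ ≢ k → k₁ ≢ k →
        Maps i k₀ α β → Maps i k₁ α γ → β ≢ γ → ¬ Maps i k β γ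
      ¬star↦triangle i≢k₀ i≢k₁ i≢k k₀≢k₁ k₀≢k k₁≢k f₀ f₁ β≢γ f
        with open-triangle (to b) (maps-≢ i≢k₀ f₀) (maps-≢ i≢k₁ f₁) β≢γ
      ... | v′ , w′ , z′ , dv , dw , dz , v∼w , v∼z , w≁z
        with surjective v′ | surjective w′ | surjective z′
      ... | v , refl | w , refl | z , refl = w≁z (preserve (_ , _ , meet-differ dw′ dz′ k₁≢k (trans
            (sym (meet-≡ dv′ dw′ k₀≢k₁ (reflect v∼w))) (meet-≡ dv′ dz′ k₀≢k (reflect v∼z)))))
        where
        dv′ = maps-reflect i≢k₀ f₀ dv
        dw′ = maps-reflect i≢k₁ f₁ dw
        dz′ = maps-reflect i≢k f dz

      ¬triangle↦star : ∀ {i j k α β γ δ} → i ≢ j → i ≢ k → j ≢ k →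
        Maps i j α β → Maps i k α γ → ¬ Maps j k α δ
      ¬triangle↦star {α = α} {β} {γ} {δ} i≢j i≢k j≢k f g h with open-triangle b i≢j i≢k j≢k
      ... | v , w , z , dv , dw , dz , v∼w , v∼z , w≁z = w≁z (reflect (_ , _ , meet-differ (g dw) (h dz) γ≢δ
            (trans (sym (meet-≡ (f dv) (g dw) β≢γ (preserve v∼w))) (meet-≡ (f dv) (h dz) β≢δ (preserve v∼z)))))
        where
        β≢γ : β ≢ γ
        β≢γ refl = maps-injective i≢j i≢k j≢k f g
        β≢δ : β ≢ δ
        β≢δ refl = maps-injective (≢-sym i≢j) j≢k i≢k (maps-swapˡ f) h
        γ≢δ : γ ≢ δ
        γ≢δ refl = maps-injective (≢-sym i≢k) (≢-sym j≢k) i≢j (maps-swapˡ g) (maps-swapˡ h)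

      opaque
        -- Pairs that meet pairwise share a position or form a triangle. The images for `k₀` and
        -- `k₁` fix the common position `α`; an image missing `α` would have to be the pair `β`,
        -- `γ`, which `¬star↦triangle` excludes.
        star : ∀ i → ∃ λ α → ∀ k → i ≢ k → ∃ λ β → Maps i k α β
        star i with third i i
        ... | k₀ , i≢k₀ , _ with third i k₀
        ...   | k₁ , i≢k₁ , k₀≢k₁ with maps-meet i≢k₀ i≢k₁ k₀≢k₁
        ...     | α , β , γ , β≢γ , f₀ , f₁ = α , rays
          where
          rays : ∀ k → i ≢ k → ∃ λ δ → Maps i k α δ
          rays k i≢k with k₀ Fin.≟ k | k₁ Fin.≟ k
          ... | yes refl | _        = β , f₀
          ... | no _     | yes refl = γ , f₁
          ... | no k₀≢k  | no k₁≢k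
            with maps-meet i≢k₀ i≢k k₀≢k | maps-meet i≢k₁ i≢k k₁≢k
          ...   | _ , _ , δ , _ , g₀ , g | _ , _ , δ′ , _ , g₁ , g′
            with maps-unique i≢k₀ f₀ g₀ | maps-unique i≢k₁ f₁ g₁
          ...     | inj₁ (refl , _)    | _                  = δ , g
          ...     | inj₂ _             | inj₁ (refl , _)    = δ′ , g′
          ...     | inj₂ (refl , refl) | inj₂ (refl , refl) with maps-unique i≢k g g′
          ...       | inj₁ (β≡γ , _)   = contradiction β≡γ β≢γ
          ...       | inj₂ (_ , refl)  =
                        ⊥-elim (¬star↦triangle i≢k₀ i≢k₁ i≢k k₀≢k₁ k₀≢k k₁≢k f₀ f₁ β≢γ g)

    -- The position to which φ moves the letter at i, read off from the edges at b.
    place : Fin (3 ℕ.+ m) → Fin (3 ℕ.+ m)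
    place i = proj₁ (star i)

    -- A coincidence would send the three pairs in a triple `i`, `j`, `k` to pairs through one
    -- position.
    place-injective : ∀ i j → i ≢ j → place i ≢ place j
    place-injective i j i≢j eq with third i j
    ... | k , i≢k , j≢k
      with proj₂ (star i) j i≢j | proj₂ (star i) k i≢k | proj₂ (star j) k j≢k
    ... | β , f | γ , g | δ , h = ¬triangle↦star i≢j i≢k j≢k f g
          (subst (λ α → Maps j k α δ) (sym eq) h)

    place-maps : ∀ {i k} → i ≢ k → Maps i k (place i) (place k)
    place-maps {i} {k} i≢k with proj₂ (star i) k i≢k | proj₂ (star k) i (≢-sym i≢k)
    ... | β , f | γ , g with maps-unique i≢k f (maps-swapˡ g)
    ...   | inj₁ (eq , _)  = contradiction eq (place-injective i k i≢k)
    ...   | inj₂ (_ , refl) = f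

-- Independence of the places from the vertex.

module ConstantPlaces (G : FinGroup) (nonAbelian : Cay.NonAbelian G) where

  open FinGroup G
  open Adjacency G
  open Lines G nonAbelian
  open LinePreservation G nonAbelian
  open Places G nonAbelian

  private variable
    m : ℕ

  module _ (p : Fin (suc m)) (u v : Vec Carrier m) where

    private
      hybrid : ℕ → Fin (suc m) → Carrier
      hybrid t j with toℕ j ℕ.<? t
      ... | yes _ = coord v j
      ... | no _  = coord u j

      hybrid-< : ∀ {t j} → toℕ j ℕ.< t → hybrid t j ≡ coord v j
      hybrid-< {t} {j} j<t with toℕ j ℕ.<? t
      ... | yes _  = refl
      ... | no j≮t = contradiction j<t j≮t

      hybrid-≮ : ∀ {t j} → ¬ toℕ j ℕ.< t → hybrid t j ≡ coord u j
      hybrid-≮ {t} {j} j≮t with toℕ j ℕ.<? t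
      ... | yes j<t = contradiction j<t j≮t
      ... | no _    = refl

      hybrid-suc : ∀ {t j} → toℕ j ≢ t → hybrid t j ≡ hybrid (suc t) j
      hybrid-suc {t} {j} j≢t with toℕ j ℕ.<? t
      ... | yes j<t = sym (hybrid-< (ℕ.m<n⇒m<1+n j<t))
      ... | no j≮t  = sym (hybrid-≮ λ j<1+t → j≮t (ℕ.≤∧≢⇒< (s≤s⁻¹ j<1+t) j≢t))

      mixed : ℕ → Vec Carrier m
      mixed t = proj₁ (prescribe (hybrid t) p)

      mixed-coord : ∀ t {j} → j ≢ p → coord (mixed t) j ≡ hybrid t j
      mixed-coord t {j} = proj₂ (prescribe (hybrid t) p) j

    -- The path from u to v alters one coordinate after the other, correcting at p.
    walk : (P : Vec Carrier m → Set) → P u →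
      (∀ {w w′} k → coord u k ≢ coord v k → Differ k p w w′ → P w → P w′) → P v
    walk P Pu step = subst P
      (coord-determined p λ j j≢p → trans (mixed-coord (suc m) j≢p) (hybrid-< (Fin.toℕ<n j)))
      (along (suc m) ℕ.≤-refl)
      where
      along : ∀ t → t ℕ.≤ suc m → P (mixed t)
      along zero    _   = subst P (coord-determined p λ j j≢p →
        sym (trans (mixed-coord 0 j≢p) (hybrid-≮ {0} λ ()))) Pu
      along (suc t) t<n = advance (k Fin.≟ p) (along t (ℕ.<⇒≤ t<n))
        where
        k : Fin (suc m)
        k = fromℕ< t<n
        k≡t : toℕ k ≡ t
        k≡t = Fin.toℕ-fromℕ< t<n
        agree : ∀ j → j ≢ k → j ≢ p → coord (mixed t) j ≡ coord (mixed (suc t)) j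
        agree j j≢k j≢p = trans (mixed-coord t j≢p) (trans
          (hybrid-suc λ j≡t → j≢k (Fin.toℕ-injective (trans j≡t (sym k≡t))))
          (sym (mixed-coord (suc t) j≢p)))
        advance : Dec (k ≡ p) → P (mixed t) → P (mixed (suc t))
        advance (yes k≡p) = subst P (coord-determined p λ j j≢p →
          agree j (λ j≡k → j≢p (trans j≡k k≡p)) j≢p)
        advance (no k≢p) with near k≢p agree
        ... | inj₁ eq = subst P eq
        ... | inj₂ d  = step k (λ uₖ≡vₖ → Differ.≢ˡ d (trans (mixed-coord t k≢p) (trans
                (hybrid-≮ λ k<t → ℕ.<-irrefl k≡t k<t) (trans uₖ≡vₖ (trans
                (sym (hybrid-< (ℕ.≤-reflexive (cong suc k≡t)))) (sym (mixed-coord (suc t) k≢p))))))) d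

  module _ (φ : Automorphism (2 ℕ.+ m)) where
    open Automorphism φ

    -- The triangle `b`, `w`, `s` has its edges over the three pairs in `i`, `k`, `j`. Seen from
    -- `w`, the pairs `i`, `k` and `k`, `j` must have the same images as seen from `b`; these two
    -- images share one position, and this separates all three.
    place-third : ∀ {b w i k j} → Differ i k b w → i ≢ j → k ≢ j →
      place φ w i ≡ place φ b i × place φ w k ≡ place φ b k × place φ w j ≡ place φ b j
    place-third {b} {w} {i} {k} {j} b-w i≢j k≢j with extend b i≢j (Differ.≢ˡ b-w)
    ... | s , b-s , sᵢ≡wᵢ = compare (differ-unique (place-maps φ w (≢-sym i≢k) (differ-sym (differ-swap b-w)))
                                                  (differ-sym (differ-swap b-w′)))
                                    (differ-unique (place-maps φ w k≢j w-s) w-s′)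
      where
      i≢k : i ≢ k
      i≢k = Differ.distinct b-w
      w-s : Differ k j w s
      w-s = meet-differ b-w b-s k≢j (sym sᵢ≡wᵢ)
      b-w′ : Differ (place φ b i) (place φ b k) (to b) (to w)
      b-w′ = place-maps φ b i≢k b-w
      b-s′ : Differ (place φ b i) (place φ b j) (to b) (to s)
      b-s′ = place-maps φ b i≢j b-s
      w-s′ : Differ (place φ b k) (place φ b j) (to w) (to s)
      w-s′ = meet-differ b-w′ b-s′ (place-injective φ b k j k≢j)
        (meet-≡ b-w′ b-s′ (place-injective φ b k j k≢j) (preserve (_ , _ , w-s)))
      compare : ∀ {i′ k′ j′} →
        (k′ ≡ place φ b k × i′ ≡ place φ b i) ⊎ (k′ ≡ place φ b i × i′ ≡ place φ b k) →
        (k′ ≡ place φ b k × j′ ≡ place φ b j) ⊎ (k′ ≡ place φ b j × j′ ≡ place φ b k) →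
        i′ ≡ place φ b i × k′ ≡ place φ b k × j′ ≡ place φ b j
      compare (inj₁ (k≡ , i≡)) (inj₁ (_ , j≡))   = i≡ , k≡ , j≡
      compare (inj₁ (k≡ , _))  (inj₂ (k≡′ , _))  =
        contradiction (trans (sym k≡) k≡′) (place-injective φ b k j k≢j)
      compare (inj₂ (k≡ , _))  (inj₁ (k≡′ , _))  =
        contradiction (trans (sym k≡) k≡′) (place-injective φ b i k i≢k)
      compare (inj₂ (k≡ , _))  (inj₂ (k≡′ , _))  =
        contradiction (trans (sym k≡) k≡′) (place-injective φ b i j i≢j)

    place-step : ∀ {b w i k} → Differ i k b w → ∀ l → place φ w l ≡ place φ b l
    place-step {b} {w} {i} {k} d l with i Fin.≟ l | k Fin.≟ l | third i k
    ... | yes refl | _        | j , i≢j , k≢j = proj₁ (place-third d i≢j k≢j)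
    ... | no _     | yes refl | j , i≢j , k≢j = proj₁ (proj₂ (place-third d i≢j k≢j))
    ... | no i≢l   | no k≢l   | _             = proj₂ (proj₂ (place-third d i≢l k≢l))

    place-constant : ∀ u v l → place φ v l ≡ place φ u l
    place-constant u v = walk zero u v (λ w → ∀ l → place φ w l ≡ place φ u l) (λ _ → refl)
      λ _ _ d eq l → trans (place-step d l) (eq l)

    -- Walk from `u` to `v` with all corrections at some `p` other than `i`. No step touches `i`,
    -- since `u` and `v` agree there, so no image step touches the place of `i`.
    place-coord : ∀ b {u v} i → coord u i ≡ coord v i →
      coord (to u) (place φ b i) ≡ coord (to v) (place φ b i)
    place-coord b {u} {v} i uᵢ≡vᵢ with third i i
    ... | p , i≢p , _ = walk p u v (λ w → coord (to u) (place φ b i) ≡ coord (to w) (place φ b i)) refl step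
      where
      step : ∀ {w w′} k → coord u k ≢ coord v k → Differ k p w w′ →
        coord (to u) (place φ b i) ≡ coord (to w) (place φ b i) →
        coord (to u) (place φ b i) ≡ coord (to w′) (place φ b i)
      step {w} k uₖ≢vₖ d eq rewrite place-constant w b i = trans eq
        (Differ.agree (place-maps φ w (Differ.distinct d) d) _
          (place-injective φ w i k λ { refl → uₖ≢vₖ uᵢ≡vᵢ }) (place-injective φ w i p i≢p))

-- One letter map, and its product law against the cyclic order.

module MonomialForm (G : FinGroup) (nonAbelian : Cay.NonAbelian G) where

  open FinGroup G
  open Differences G
  open Adjacency G
  open Lines G nonAbelian
  open LinePreservation G nonAbelian
  open Places G nonAbelian
  open ConstantPlaces G nonAbelian

  private variable
    m n : ℕ

  injective⇒surjective : (f : Fin n → Fin n) → (∀ {i j} → f i ≡ f j → i ≡ j) → ∀ j → ∃ λ i → f i ≡ j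
  injective⇒surjective {suc n} f inj j with Fin.any? (λ i → f i Fin.≟ j)
  ... | yes hit = hit
  ... | no miss = contradiction
    (Fin.injective⇒≤ {f = λ i → Fin.punchOut λ j≡fi → miss (i , sym j≡fi)}
      λ {i} {k} eq → inj (Fin.punchOut-injective (λ j≡fi → miss (i , sym j≡fi)) (λ j≡fk → miss (k , sym j≡fk)) eq))
    ℕ.1+n≰n

  -- A product of three letters equal to `ε` may be rotated, so a word with three nontrivial letters
  -- sees only the cyclic order of their positions.
  data Cyclic {n} (i j k : Fin n) : Set where
    ijk : i Fin.< j → j Fin.< k → Cyclic i j k
    jki : j Fin.< k → k Fin.< i → Cyclic i j k
    kij : k Fin.< i → i Fin.< j → Cyclic i j k

  cyclic-distinct : ∀ {i j k : Fin n} → Cyclic i j k → i ≢ j × i ≢ k × j ≢ k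
  cyclic-distinct (ijk i<j j<k) = Fin.<⇒≢ i<j , Fin.<⇒≢ (ℕ.<-trans i<j j<k) , Fin.<⇒≢ j<k
  cyclic-distinct (jki j<k k<i) = ≢-sym (Fin.<⇒≢ (ℕ.<-trans j<k k<i)) , ≢-sym (Fin.<⇒≢ k<i) , Fin.<⇒≢ j<k
  cyclic-distinct (kij k<i i<j) = Fin.<⇒≢ i<j , ≢-sym (Fin.<⇒≢ k<i) , ≢-sym (Fin.<⇒≢ (ℕ.<-trans k<i i<j))

  cyclic-total : ∀ {i j k : Fin n} → i ≢ j → i ≢ k → j ≢ k → Cyclic i j k ⊎ Cyclic i k j
  cyclic-total {i = i} {j} {k} i≢j i≢k j≢k with Fin.<-cmp i j | Fin.<-cmp i k | Fin.<-cmp j k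
  ... | tri≈ _ i≡j _ | _            | _            = contradiction i≡j i≢j
  ... | tri< _ _ _   | tri≈ _ i≡k _ | _            = contradiction i≡k i≢k
  ... | tri> _ _ _   | tri≈ _ i≡k _ | _            = contradiction i≡k i≢k
  ... | tri< _ _ _   | tri< _ _ _   | tri≈ _ j≡k _ = contradiction j≡k j≢k
  ... | tri< _ _ _   | tri> _ _ _   | tri≈ _ j≡k _ = contradiction j≡k j≢k
  ... | tri> _ _ _   | tri< _ _ _   | tri≈ _ j≡k _ = contradiction j≡k j≢k
  ... | tri> _ _ _   | tri> _ _ _   | tri≈ _ j≡k _ = contradiction j≡k j≢k
  ... | tri< i<j _ _ | tri< _ _ _   | tri< j<k _ _ = inj₁ (ijk i<j j<k)
  ... | tri< _ _ _   | tri< i<k _ _ | tri> _ _ k<j = inj₂ (ijk i<k k<j)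
  ... | tri< i<j _ _ | tri> _ _ k<i | _            = inj₁ (kij k<i i<j)
  ... | tri> _ _ j<i | tri< i<k _ _ | _            = inj₂ (kij j<i i<k)
  ... | tri> _ _ j<i | tri> _ _ k<i | tri< j<k _ _ = inj₁ (jki j<k k<i)
  ... | tri> _ _ j<i | tri> _ _ k<i | tri> _ _ k<j = inj₂ (jki k<j j<i)

  ∙-rotate : ∀ {x y z} → x ∙ (y ∙ z) ≡ ε → y ∙ (z ∙ x) ≡ ε
  ∙-rotate {x} {y} {z} eq = trans (sym (assoc y z x))
    (trans (cong (y ∙ z ∙_) (inverseˡ-unique x (y ∙ z) eq)) (inverseʳ (y ∙ z)))

  opaque
    support₃ : ∀ (v : Vec Carrier m) {i j k} → Cyclic i j k →
      (∀ l → l ≢ i → l ≢ j → l ≢ k → coord v l ≡ ε) → coord v i ∙ (coord v j ∙ coord v k) ≡ ε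
    support₃ v (ijk i<j j<k) eq = trans (sym (∏-support₃ (diffs ε v ε) i<j j<k eq)) (∏-coord v)
    support₃ v (jki j<k k<i) eq = ∙-rotate (∙-rotate (trans
      (sym (∏-support₃ (diffs ε v ε) j<k k<i λ l l≢j l≢k l≢i → eq l l≢i l≢j l≢k)) (∏-coord v)))
    support₃ v (kij k<i i<j) eq = ∙-rotate (trans
      (sym (∏-support₃ (diffs ε v ε) k<i i<j λ l l≢k l≢i l≢j → eq l l≢i l≢j l≢k)) (∏-coord v))

  Bijective : (Carrier → Carrier) → Set
  Bijective f = (∀ {x y} → f x ≡ f y → x ≡ y) × (∀ y → ∃ λ x → f x ≡ y)

  record Monomial (φ : Vec Carrier m → Vec Carrier m) : Set where
    field
      π          : Fin (suc m) → Fin (suc m)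
      f          : Carrier → Carrier
      action     : ∀ v i → coord (φ v) (π i) ≡ f (coord v i)
      bijective  : Bijective f

    Direct : Set
    Direct = (∀ {i j k} → Cyclic i j k → Cyclic (π i) (π j) (π k)) × (∀ x y → f (x ∙ y) ≡ f x ∙ f y)

    Reversed : Set
    Reversed = (∀ {i j k} → Cyclic i j k → Cyclic (π i) (π k) (π j)) × (∀ x y → f (x ∙ y) ≡ f y ∙ f x)

  module _ (φ : Automorphism (2 ℕ.+ m)) (φ𝐞≡𝐞 : Automorphism.to φ (replicate (2 ℕ.+ m) ε) ≡ replicate (2 ℕ.+ m) ε) where
    open Automorphism φ

    private
      𝐞 : Vec Carrier (2 ℕ.+ m)
      𝐞 = replicate (2 ℕ.+ m) ε

      π : Fin (3 ℕ.+ m) → Fin (3 ℕ.+ m)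
      π = place φ 𝐞

      π-≢ : ∀ {i j} → i ≢ j → π i ≢ π j
      π-≢ = place-injective φ 𝐞 _ _

      π-surjective : ∀ j → ∃ λ i → π i ≡ j
      π-surjective = injective⇒surjective π λ {i} {j} eq →
        decidable-stable (i Fin.≟ j) λ i≢j → π-≢ i≢j eq

      sample : ∀ (i : Fin (3 ℕ.+ m)) x → ∃ λ (v : Vec Carrier (2 ℕ.+ m)) → coord v i ≡ x
      sample i x = let k , i≢k , _ = third i i ; v , eq = prescribe (λ _ → x) k in v , eq i i≢k

      value : Fin (3 ℕ.+ m) → Carrier → Carrier
      value i x = coord (to (proj₁ (sample i x))) (π i)

      -- By `place-coord` the image letter depends on the letter at `i` alone, so the arbitrary
      -- completion chosen in `sample` does not matter.
      value-coord : ∀ v i → coord (to v) (π i) ≡ value i (coord v i)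
      value-coord v i = place-coord φ 𝐞 i (sym (proj₂ (sample i (coord v i))))

      value-ε : ∀ i → value i ε ≡ ε
      value-ε i = trans (sym (trans (value-coord 𝐞 i) (cong (value i) (coord-𝐞 i))))
        (trans (cong (λ v → coord v (π i)) φ𝐞≡𝐞) (coord-𝐞 (π i)))

      value-trivial : ∀ v i → coord v i ≡ ε → coord (to v) (π i) ≡ ε
      value-trivial v i eq = trans (value-coord v i) (trans (cong (value i) eq) (value-ε i))

      pair : ∀ {i k} → i ≢ k → ∀ x → ∃ λ (v : Vec Carrier (2 ℕ.+ m)) → coord v i ≡ x × (∀ j → j ≢ i → j ≢ k → coord v j ≡ ε)
      pair {i} {k} i≢k x = let v , eq = prescribe ((λ _ → ε) [ i ≔ x ]) k in
        v , trans (eq i i≢k) (≔-updates (λ _ → ε) i x) , λ j j≢i j≢k → trans (eq j j≢k) (≔-minimal (λ _ → ε) x j≢i)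

      -- The word with `x` at `i` and its inverse at `k` goes to a word that is trivial elsewhere,
      -- whose two letters must again be mutually inverse.
      value-⁻¹ : ∀ {i k} → i ≢ k → ∀ x → value k (x ⁻¹) ≡ value i x ⁻¹
      value-⁻¹ {i} {k} i≢k x with pair i≢k x
      ... | v , vᵢ≡x , v≡ε = begin
        value k (x ⁻¹)           ≡⟨ cong (value k) (trans (cong _⁻¹ (sym vᵢ≡x)) (sym (support₂ v i≢k v≡ε))) ⟩
        value k (coord v k)      ≡⟨ sym (value-coord v k) ⟩
        coord (to v) (π k)       ≡⟨ support₂ (to v) (π-≢ i≢k) image≡ε ⟩
        coord (to v) (π i) ⁻¹    ≡⟨ cong _⁻¹ (trans (value-coord v i) (cong (value i) vᵢ≡x)) ⟩
        value i x ⁻¹             ∎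
        where
        open ≡-Reasoning
        image≡ε : ∀ j → j ≢ π i → j ≢ π k → coord (to v) j ≡ ε
        image≡ε j j≢πi j≢πk with π-surjective j
        ... | l , refl = value-trivial v l (v≡ε l (j≢πi ∘ cong π) (j≢πk ∘ cong π))

      value-constant : ∀ i j x → value i x ≡ value j x
      value-constant i j x with third i j
      ... | k , i≢k , j≢k = ⁻¹-injective (trans (sym (value-⁻¹ i≢k x)) (value-⁻¹ j≢k x))

      f : Carrier → Carrier
      f = value zero

      f-coord : ∀ v i → coord (to v) (π i) ≡ f (coord v i)
      f-coord v i = trans (value-coord v i) (value-constant i zero (coord v i))

      f-⁻¹ : ∀ x → f (x ⁻¹) ≡ f x ⁻¹
      f-⁻¹ x = trans (value-constant zero (suc zero) (x ⁻¹)) (value-⁻¹ (λ ()) x)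

      f-injective : ∀ {x y} → f x ≡ f y → x ≡ y
      f-injective {x} {y} fx≡fy with sample zero x
      ... | v , v₀≡x = decidable-stable (x ≟ y) λ x≢y →
        let w , v-w , w₀≡y = extend v {zero} {suc zero} (λ ()) (λ v₀≡y → x≢y (trans (sym v₀≡x) v₀≡y))
        in Differ.≢ˡ (place-maps φ v (λ ()) v-w)
          -- `place-maps` refers to the places at `v`, whereas `f-coord` refers to those at `𝐞`.
          (subst (λ l → coord (to v) l ≡ coord (to w) l) (place-constant φ v 𝐞 zero)
            (trans (f-coord v zero) (trans (cong f v₀≡x) (trans fx≡fy
              (trans (cong f (sym w₀≡y)) (sym (f-coord w zero)))))))

      f-surjective : ∀ y → ∃ λ x → f x ≡ y
      f-surjective y with sample (π zero) y
      ... | v′ , v′≡y with surjective v′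
      ...   | v , refl = coord v zero , trans (sym (f-coord v zero)) v′≡y

      triple : ∀ {i j k} → Cyclic i j k → ∀ x y → ∃ λ (v : Vec Carrier (2 ℕ.+ m)) →
        coord v i ≡ x × coord v j ≡ y × coord v k ≡ (x ∙ y) ⁻¹ × (∀ l → l ≢ i → l ≢ j → l ≢ k → coord v l ≡ ε)
      triple {i} {j} {k} cyc x y with cyclic-distinct cyc
      ... | i≢j , i≢k , j≢k with prescribe (((λ _ → ε) [ i ≔ x ]) [ j ≔ y ]) k
      ...   | v , eq = v , vᵢ≡x , vⱼ≡y , inverseʳ-unique (x ∙ y) (coord v k)
                (trans (assoc x y _) (trans (cong₂ (λ a b → a ∙ (b ∙ coord v k)) (sym vᵢ≡x) (sym vⱼ≡y))
                  (support₃ v cyc v≡ε))) , v≡ε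
        where
        vᵢ≡x = trans (eq i i≢k) (trans (≔-minimal ((λ _ → ε) [ i ≔ x ]) y i≢j) (≔-updates (λ _ → ε) i x))
        vⱼ≡y = trans (eq j j≢k) (≔-updates ((λ _ → ε) [ i ≔ x ]) j y)
        v≡ε : ∀ l → l ≢ i → l ≢ j → l ≢ k → coord v l ≡ ε
        v≡ε l l≢i l≢j l≢k = trans (eq l l≢k) (trans (≔-minimal ((λ _ → ε) [ i ≔ x ]) y l≢j) (≔-minimal (λ _ → ε) x l≢i))

      module _ {i j k : Fin (3 ℕ.+ m)} (cyc : Cyclic i j k) (x y : Carrier) where
        v : Vec Carrier (2 ℕ.+ m)
        v = proj₁ (triple cyc x y)

        image≡ε : ∀ l → l ≢ π i → l ≢ π j → l ≢ π k → coord (to v) l ≡ ε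
        image≡ε l l≢πi l≢πj l≢πk with π-surjective l
        ... | p , refl = value-trivial v p (proj₂ (proj₂ (proj₂ (proj₂ (triple cyc x y)))) p
                (l≢πi ∘ cong π) (l≢πj ∘ cong π) (l≢πk ∘ cong π))

        image-i : coord (to v) (π i) ≡ f x
        image-i = trans (f-coord v i) (cong f (proj₁ (proj₂ (triple cyc x y))))

        image-j : coord (to v) (π j) ≡ f y
        image-j = trans (f-coord v j) (cong f (proj₁ (proj₂ (proj₂ (triple cyc x y)))))

        image-k : coord (to v) (π k) ≡ f (x ∙ y) ⁻¹
        image-k = trans (f-coord v k) (trans (cong f (proj₁ (proj₂ (proj₂ (proj₂ (triple cyc x y)))))) (f-⁻¹ _))

        -- The image word has letters `f x`, `f y` and `f (x ∙ y) ⁻¹`; multiplied in the cyclic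
        -- order of their new places they give `ε`.
        direct-hom : Cyclic (π i) (π j) (π k) → f (x ∙ y) ≡ f x ∙ f y
        direct-hom cyc′ = sym (x∙y⁻¹≈ε⇒x≈y _ _ (trans (assoc _ _ _) (trans
          (sym (cong₂ _∙_ image-i (cong₂ _∙_ image-j image-k)))
          (support₃ (to v) cyc′ image≡ε))))

        reversed-hom : Cyclic (π i) (π k) (π j) → f (x ∙ y) ≡ f y ∙ f x
        reversed-hom cyc′ = sym (x∙y⁻¹≈ε⇒x≈y _ _ (trans (assoc _ _ _) (∙-rotate (∙-rotate (trans
          (sym (cong₂ _∙_ image-i (cong₂ _∙_ image-k image-j)))
          (support₃ (to v) cyc′ λ l l≢i l≢k l≢j → image≡ε l l≢i l≢j l≢k))))))

      ¬both : (∀ x y → f (x ∙ y) ≡ f x ∙ f y) → ¬ (∀ x y → f (x ∙ y) ≡ f y ∙ f x)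
      ¬both hom anti = nonAbelian λ x y → f-injective (trans (hom x y) (sym (anti y x)))

      orient : ∀ {i j k} → Cyclic i j k → Cyclic (π i) (π j) (π k) ⊎ Cyclic (π i) (π k) (π j)
      orient cyc = let i≢j , i≢k , j≢k = cyclic-distinct cyc in
        cyclic-total (π-≢ i≢j) (π-≢ i≢k) (π-≢ j≢k)

    monomial : Monomial to
    monomial = record { π = π ; f = f ; action = f-coord ; bijective = f-injective , f-surjective }

    -- The triple 0, 1, 2 settles which law `f` obeys. As `f` is the same at all positions, a triple
    -- oriented the other way would impose the opposite law too, and `¬both` forbids this.
    direct-or-reversed : Monomial.Direct monomial ⊎ Monomial.Reversed monomial
    direct-or-reversed with orient 012-cyclic
      where
      012-cyclic : Cyclic {3 ℕ.+ m} zero (suc zero) (suc (suc zero))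
      012-cyclic = ijk z<s (s<s z<s)
    ... | inj₁ cyc₀ = inj₁ ((λ cyc → [ id , (λ cyc′ → ⊥-elim (¬both hom λ x y → reversed-hom cyc x y cyc′)) ]′
                              (orient cyc)) , hom)
      where
      hom : ∀ x y → f (x ∙ y) ≡ f x ∙ f y
      hom x y = direct-hom (ijk z<s (s<s z<s)) x y cyc₀
    ... | inj₂ cyc₀ = inj₂ ((λ cyc → [ (λ cyc′ → ⊥-elim (¬both (λ x y → direct-hom cyc x y cyc′) anti)) , id ]′
                              (orient cyc)) , anti)
      where
      anti : ∀ x y → f (x ∙ y) ≡ f y ∙ f x
      anti x y = reversed-hom (ijk z<s (s<s z<s)) x y cyc₀

-- Rotation and reflection of positions, and their effect on words.

module Positions (G : FinGroup) (nonAbelian : Cay.NonAbelian G) where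

  open FinGroup G
  open Cay G
  open Differences G
  open Adjacency G
  open MonomialForm G nonAbelian

  private variable
    m n : ℕ

  prev : Fin (suc n) → Fin (suc n)
  prev zero    = fromℕ _
  prev (suc i) = inject₁ i

  opposite-fromℕ : ∀ n → opposite (fromℕ n) ≡ zero
  opposite-fromℕ zero    = refl
  opposite-fromℕ (suc n) = cong inject₁ (opposite-fromℕ n)

  opposite-inject₁ : ∀ (i : Fin n) → opposite (inject₁ i) ≡ suc (opposite i)
  opposite-inject₁ zero    = refl
  opposite-inject₁ (suc i) = cong inject₁ (opposite-inject₁ i)

  -- The dihedral relation. It makes `opposite ∘ prev ∘ opposite` the inverse of `prev`, which gives
  -- injectivity and surjectivity below.
  prev-opposite-prev : ∀ (i : Fin (suc n)) → prev (opposite (prev i)) ≡ opposite i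
  prev-opposite-prev {n} zero = cong prev (opposite-fromℕ n)
  prev-opposite-prev (suc i)  = cong prev (opposite-inject₁ i)

  opposite-injective : ∀ {i j : Fin n} → opposite i ≡ opposite j → i ≡ j
  opposite-injective {i = i} {j} eq =
    trans (sym (Fin.opposite-involutive i)) (trans (cong opposite eq) (Fin.opposite-involutive j))

  prev-injective : ∀ {i j : Fin (suc n)} → prev i ≡ prev j → i ≡ j
  prev-injective {i = i} {j} eq = opposite-injective
    (trans (sym (prev-opposite-prev i)) (trans (cong (prev ∘ opposite) eq) (prev-opposite-prev j)))

  prev-surjective : ∀ (j : Fin (suc n)) → ∃ λ i → prev i ≡ j
  prev-surjective j = opposite (prev (opposite j)) ,
    trans (prev-opposite-prev (opposite j)) (Fin.opposite-involutive j)

  opposite-surjective : ∀ (j : Fin n) → ∃ λ i → opposite i ≡ j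
  opposite-surjective j = opposite j , Fin.opposite-involutive j

  opposite-antitone : ∀ {i j : Fin n} → i Fin.< j → opposite j Fin.< opposite i
  opposite-antitone {n} {i} {j} i<j = subst₂ ℕ._<_ (sym (Fin.opposite-prop j)) (sym (Fin.opposite-prop i))
    (ℕ.∸-monoʳ-< (s<s i<j) (Fin.toℕ<n j))

  cyclic-rotate : ∀ {i j k : Fin n} → Cyclic i j k → Cyclic j k i
  cyclic-rotate (ijk i<j j<k) = kij i<j j<k
  cyclic-rotate (jki j<k k<i) = ijk j<k k<i
  cyclic-rotate (kij k<i i<j) = jki k<i i<j

  cyclic-opposite : ∀ {i j k : Fin n} → Cyclic i j k → Cyclic (opposite i) (opposite k) (opposite j)
  cyclic-opposite (ijk i<j j<k) = jki (opposite-antitone j<k) (opposite-antitone i<j)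
  cyclic-opposite (jki j<k k<i) = ijk (opposite-antitone k<i) (opposite-antitone j<k)
  cyclic-opposite (kij k<i i<j) = kij (opposite-antitone i<j) (opposite-antitone k<i)

  inject₁-mono : ∀ {i j : Fin n} → i Fin.< j → inject₁ i Fin.< inject₁ j
  inject₁-mono {i = i} {j} = subst₂ ℕ._<_ (sym (Fin.toℕ-inject₁ i)) (sym (Fin.toℕ-inject₁ j))

  inject₁<fromℕ : ∀ (i : Fin n) → inject₁ i Fin.< fromℕ n
  inject₁<fromℕ {n} i = subst₂ ℕ._<_ (sym (Fin.toℕ-inject₁ i)) (sym (Fin.toℕ-fromℕ n)) (Fin.toℕ<n i)

  cyclic-prev : ∀ {i j k : Fin (suc n)} → Cyclic i j k → Cyclic (prev i) (prev j) (prev k)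
  cyclic-prev (ijk i<j j<k) = linear i<j j<k
    where
    linear : ∀ {i j k : Fin (suc n)} → i Fin.< j → j Fin.< k → Cyclic (prev i) (prev j) (prev k)
    linear {i = zero}  {suc j} {suc k} _         (s<s j<k) = jki (inject₁-mono j<k) (inject₁<fromℕ k)
    linear {i = suc i} {suc j} {suc k} (s<s i<j) (s<s j<k) = ijk (inject₁-mono i<j) (inject₁-mono j<k)
  cyclic-prev (jki j<k k<i) = cyclic-rotate (cyclic-rotate (cyclic-prev (ijk j<k k<i)))
  cyclic-prev (kij k<i i<j) = cyclic-rotate (cyclic-prev (ijk k<i i<j))

  expansive : ∀ (f : Fin n → Fin n) → (∀ {i j} → i Fin.< j → f i Fin.< f j) → ∀ i → i Fin.≤ f i
  expansive f mono i = go (toℕ i) i refl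
    where
    -- `inject₁ i` is not a structural part of `suc i`, so the recursion runs on the numerical
    -- value.
    go : ∀ t i → toℕ i ≡ t → i Fin.≤ f i
    go _       zero    _  = z≤n
    go (suc t) (suc i) eq = ℕ.≤-<-trans
      (subst (ℕ._≤ toℕ (f (inject₁ i))) (Fin.toℕ-inject₁ i)
        (go t (inject₁ i) (trans (Fin.toℕ-inject₁ i) (ℕ.suc-injective eq))))
      (mono (s≤s (ℕ.≤-reflexive (Fin.toℕ-inject₁ i))))

  -- Conjugation by `opposite` turns the lower bound of `expansive` into the upper bound.
  strictlyMonotone⇒id : ∀ (f : Fin n → Fin n) → (∀ {i j} → i Fin.< j → f i Fin.< f j) → ∀ i → f i ≡ i
  strictlyMonotone⇒id f mono i = Fin.≤-antisym fi≤i (expansive f mono i)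
    where
    reflected : opposite i Fin.≤ opposite (f i)
    reflected = subst (λ j → opposite i Fin.≤ opposite (f j)) (Fin.opposite-involutive i)
      (expansive (opposite ∘ f ∘ opposite) (λ i<j → opposite-antitone (mono (opposite-antitone i<j))) (opposite i))
    fi≤i : f i Fin.≤ i
    fi≤i = ℕ.≮⇒≥ λ i<fi → ℕ.<-irrefl refl (ℕ.<-≤-trans (opposite-antitone {i = i} {f i} i<fi) reflected)

  -- The first step wraps from `zero` to the top position `m`, and each of the other `k` steps
  -- lowers it by one; the sum avoids truncated subtraction.
  prev-iterate : ∀ k → k ℕ.≤ m → toℕ (fold zero (prev {m}) (suc k)) ℕ.+ k ≡ m
  prev-iterate {m} zero _ = trans (ℕ.+-identityʳ _) (Fin.toℕ-fromℕ m)
  prev-iterate {m} (suc k) k<m with fold zero (prev {m}) (suc k) | prev-iterate k (ℕ.<⇒≤ k<m)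
  ... | zero  | k≡m = contradiction k≡m (ℕ.<⇒≢ k<m)
  ... | suc i | eq  = trans (ℕ.+-suc _ k) (trans (cong (λ t → suc (t ℕ.+ k)) (Fin.toℕ-inject₁ i)) eq)

  prev-reaches : ∀ (i : Fin (suc m)) → ∃ λ k → fold zero prev k ≡ i
  prev-reaches {m} i = suc (m ℕ.∸ toℕ i) , Fin.toℕ-injective
    (ℕ.+-cancelʳ-≡ (m ℕ.∸ toℕ i) _ _ (trans (prev-iterate _ (ℕ.m∸n≤m m (toℕ i)))
      (sym (ℕ.m+[n∸m]≡n (s≤s⁻¹ (Fin.toℕ<n i))))))

  module _ {A : Set} (s : A → A) where

    fold-comm : ∀ x j k → fold (fold x s j) s k ≡ fold (fold x s k) s j
    fold-comm x j k = trans (sym (fold-+ x s k)) (trans (cong (fold x s) (ℕ.+-comm k j)) (fold-+ x s j))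

  -- Every position is an iterate of `zero` and iterates commute, so it suffices to return to
  -- `zero`.
  prev-period : ∀ (i : Fin (suc m)) → fold i prev (suc m) ≡ i
  prev-period {m} i with prev-reaches i
  ... | k , refl = trans (fold-comm prev zero k (suc m)) (cong (λ j → fold j prev k)
    (Fin.toℕ-injective (ℕ.m+n≡0⇒m≡0 _ {0} (ℕ.+-cancelʳ-≡ m _ 0
      (trans (cong (ℕ._+ m) (ℕ.+-identityʳ _)) (prev-iterate m ℕ.≤-refl))))))

  prev-iterate-injective : ∀ {j k} → j ℕ.≤ m → k ℕ.≤ m →
    fold zero (prev {m}) j ≡ fold zero prev k → j ≡ k
  prev-iterate-injective {j = zero}  {zero}  _ _ _ = refl
  prev-iterate-injective {j = zero}  {suc k} _ k<m eq = contradiction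
    (trans (cong (λ i → toℕ i ℕ.+ k) eq) (prev-iterate k (ℕ.<⇒≤ k<m))) (ℕ.<⇒≢ k<m)
  prev-iterate-injective {j = suc j} {zero}  j<m _ eq = contradiction
    (trans (cong (λ i → toℕ i ℕ.+ j) (sym eq)) (prev-iterate j (ℕ.<⇒≤ j<m))) (ℕ.<⇒≢ j<m)
  prev-iterate-injective {m} {suc j} {suc k} j<m k<m eq = cong suc (ℕ.+-cancelˡ-≡ (toℕ (fold zero (prev {m}) (suc j))) j k
    (trans (prev-iterate j (ℕ.<⇒≤ j<m)) (sym (trans (cong (λ i → toℕ i ℕ.+ k) eq) (prev-iterate k (ℕ.<⇒≤ k<m))))))

  module _ {m : ℕ} where
    open On m

    coord-τ : ∀ g i → coord (τ g) (opposite i) ≡ coord g i ⁻¹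
    coord-τ g i = begin
      lookup (diffs ε (reverse g) ε) (opposite i)             ≡⟨ cong (λ w → lookup w (opposite i)) (diffs-reverse ε g ε) ⟩
      lookup (reverse (map _⁻¹ (diffs ε g ε))) (opposite i)   ≡⟨ lookup-reverse (map _⁻¹ (diffs ε g ε)) i ⟩
      lookup (map _⁻¹ (diffs ε g ε)) i                        ≡⟨ Vec.lookup-map i _⁻¹ (diffs ε g ε) ⟩
      lookup (diffs ε g ε) i ⁻¹                               ∎
      where open ≡-Reasoning

  -- Without its leading `ε` the padded sequence is `x`, `g`, `ε`. Multiplying it by `x ⁻¹` keeps
  -- the quotients and makes it start at `ε` and end at `x ⁻¹`; the new right end `ε` then adds the
  -- quotient `x`, formerly the first letter.
  diffs-ω : ∀ x (g : Vec Carrier m) → diffs ε (On.ω (suc m) (x ∷ g)) ε ≡ diffs x g ε ∷ʳ x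
  diffs-ω x g = begin
    diffs ε (map (x ⁻¹ ∙_) g ∷ʳ x ⁻¹) ε                                ≡⟨ diffs-∷ʳ ε (map (x ⁻¹ ∙_) g) (x ⁻¹) ε ⟩
    diffs ε (map (x ⁻¹ ∙_) g) (x ⁻¹) ∷ʳ (x ⁻¹ \\ ε)                    ≡⟨ cong₂ (λ p q → diffs p (map (x ⁻¹ ∙_) g) q ∷ʳ (x ⁻¹ \\ ε)) (sym (inverseˡ x)) (sym (identityʳ (x ⁻¹))) ⟩
    diffs (x ⁻¹ ∙ x) (map (x ⁻¹ ∙_) g) (x ⁻¹ ∙ ε) ∷ʳ (x ⁻¹ \\ ε)       ≡⟨ cong₂ _∷ʳ_ (diffs-map-∙ (x ⁻¹) x g ε) (trans (identityʳ _) (⁻¹-involutive x)) ⟩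
    diffs x g ε ∷ʳ x                                                   ∎
    where open ≡-Reasoning

  coord-ω : ∀ (g : Vec Carrier m) i → coord (On.ω m g) (prev i) ≡ coord g i
  coord-ω []      zero    = refl
  coord-ω {suc m} (x ∷ g) zero = trans (cong (λ w → lookup w (fromℕ (suc m))) (diffs-ω x g))
    (trans (lookup-∷ʳ-fromℕ (diffs x g ε) x) (sym (trans (cong (_∙ x) ε⁻¹≈ε) (identityˡ x))))
  coord-ω (x ∷ g) (suc i) = trans (cong (λ w → lookup w (inject₁ i)) (diffs-ω x g))
    (lookup-∷ʳ-inject₁ (diffs x g ε) x i)

  record IsHom (f : Carrier → Carrier) : Set where
    field
      homo : ∀ x y → f (x ∙ y) ≡ f x ∙ f y

    ε-homo : f ε ≡ ε
    ε-homo = identityˡ-unique (f ε) (f ε) (trans (sym (homo ε ε)) (cong f (identityˡ ε)))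

    ⁻¹-homo : ∀ x → f (x ⁻¹) ≡ f x ⁻¹
    ⁻¹-homo x = inverseʳ-unique (f x) (f (x ⁻¹))
      (trans (sym (homo x (x ⁻¹))) (trans (cong f (inverseʳ x)) ε-homo))

    coord-map : ∀ (g : Vec Carrier m) i → coord (map f g) i ≡ f (coord g i)
    coord-map g i = trans
      (cong (λ w → lookup w i) (trans (cong (λ e → diffs e (map f g) e) (sym ε-homo))
        (diffs-hom f (λ x y → trans (homo (x ⁻¹) y) (cong (_∙ f y) (⁻¹-homo x))) ε g ε)))
      (Vec.lookup-map i f (diffs ε g ε))

-- The known maps are graph automorphisms.

module GraphAutomorphisms (G : FinGroup) (nonAbelian : Cay.NonAbelian G) where

  open FinGroup G
  open Cay G
  open Differences G
  open Adjacency G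
  open Lines G nonAbelian
  open LinePreservation G nonAbelian
  open Places G nonAbelian hiding (_·_)
  open MonomialForm G nonAbelian
  open Positions G nonAbelian

  private variable
    m : ℕ

  coord-ext : ∀ {σ : Fin (suc m) → Fin (suc m)} → (∀ j → ∃ λ i → σ i ≡ j) → ∀ {g h : Vec Carrier m} →
    (∀ i → coord g (σ i) ≡ coord h (σ i)) → g ≡ h
  coord-ext σ-surjective {g} {h} eq = coord-injective λ j → let i , σi≡j = σ-surjective j in
    subst (λ j → coord g j ≡ coord h j) σi≡j (eq i)

  group-aut-hom : ∀ {f} → IsGroupAut f → IsHom f
  group-aut-hom f-aut = record { homo = proj₂ f-aut }

  bijective⇒group-aut : ∀ {f} → Bijective f → (∀ x y → f (x ∙ y) ≡ f x ∙ f y) → IsGroupAut f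
  bijective⇒group-aut (f-injective , f-surjective) homo =
    (f-injective , λ y → proj₁ (f-surjective y) , λ { refl → proj₂ (f-surjective y) }) , homo

  group-aut-bijective : ∀ {f} → IsGroupAut f → Bijective f
  group-aut-bijective ((f-injective , f-surjective) , _) =
    f-injective , λ y → proj₁ (f-surjective y) , proj₂ (f-surjective y) refl

  bijective-∘ : ∀ {f g} → Bijective f → Bijective g → Bijective (f ∘ g)
  bijective-∘ {f} (f-injective , f-surjective) (g-injective , g-surjective) =
    g-injective ∘ f-injective , λ z →
      let y , fy≡z = f-surjective z ; x , gx≡y = g-surjective y in x , trans (cong f gx≡y) fy≡z

  group-aut-id : IsGroupAut id
  group-aut-id = bijective⇒group-aut (id , λ y → y , refl) λ _ _ → refl

  group-aut-∘ : ∀ {f g} → IsGroupAut f → IsGroupAut g → IsGroupAut (f ∘ g)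
  group-aut-∘ {f} {g} f-aut g-aut = bijective⇒group-aut
    (bijective-∘ (group-aut-bijective f-aut) (group-aut-bijective g-aut))
    λ x y → trans (cong f (proj₂ g-aut x y)) (proj₂ f-aut (g x) (g y))

  conj : Carrier → Carrier → Carrier
  conj a x = a ∙ x ∙ a ⁻¹

  conj-aut : ∀ a → IsGroupAut (conj a)
  conj-aut a = bijective⇒group-aut
    ((λ {x} {y} eq → ∙-cancelˡ a x y (∙-cancelʳ (a ⁻¹) _ _ eq)) ,
     λ y → a ⁻¹ ∙ y ∙ a , trans (cong (_∙ a ⁻¹) (trans (cong (a ∙_) (assoc _ _ _)) (\\-leftDividesˡ a (y ∙ a))))
       (//-rightDividesʳ a y))
    λ x y → begin
      a ∙ (x ∙ y) ∙ a ⁻¹                  ≡⟨ cong (_∙ a ⁻¹) (sym (assoc a x y)) ⟩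
      a ∙ x ∙ y ∙ a ⁻¹                    ≡⟨ cong (λ z → z ∙ y ∙ a ⁻¹) (sym (//-rightDividesˡ a (a ∙ x))) ⟩
      a ∙ x ∙ a ⁻¹ ∙ a ∙ y ∙ a ⁻¹         ≡⟨ cong (_∙ a ⁻¹) (assoc _ a y) ⟩
      a ∙ x ∙ a ⁻¹ ∙ (a ∙ y) ∙ a ⁻¹       ≡⟨ assoc _ _ _ ⟩
      a ∙ x ∙ a ⁻¹ ∙ (a ∙ y ∙ a ⁻¹)       ∎
    where open ≡-Reasoning

  zipWith-∷ʳ : ∀ (g h : Vec Carrier m) x y → zipWith _∙_ (g ∷ʳ x) (h ∷ʳ y) ≡ zipWith _∙_ g h ∷ʳ (x ∙ y)
  zipWith-∷ʳ []      []      x y = refl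
  zipWith-∷ʳ (a ∷ g) (b ∷ h) x y = cong (a ∙ b ∷_) (zipWith-∷ʳ g h x y)

  reverse-zipWith : ∀ (g h : Vec Carrier m) → reverse (zipWith _∙_ g h) ≡ zipWith _∙_ (reverse g) (reverse h)
  reverse-zipWith []      []      = refl
  reverse-zipWith (x ∷ g) (y ∷ h) rewrite Vec.reverse-∷ x g | Vec.reverse-∷ y h
    | Vec.reverse-∷ (x ∙ y) (zipWith _∙_ g h) | reverse-zipWith g h = sym (zipWith-∷ʳ (reverse g) (reverse h) x y)

  map-zipWith : ∀ {f} → (∀ x y → f (x ∙ y) ≡ f x ∙ f y) → ∀ (g h : Vec Carrier m) →
    map f (zipWith _∙_ g h) ≡ zipWith _∙_ (map f g) (map f h)
  map-zipWith homo []      []      = refl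
  map-zipWith homo (x ∷ g) (y ∷ h) = cong₂ _∷_ (homo x y) (map-zipWith homo g h)

  -- With `a` and `c` the inverses of the two first entries this computes `ω` of a product. The
  -- factor `a` lands on the left of every entry, where no right translation can put it; conjugation
  -- by `a` moves it across.
  ω-zipWith : ∀ a c (g h : Vec Carrier m) →
    map ((a ∙ c) ∙_) (zipWith _∙_ g h) ∷ʳ (a ∙ c) ≡
    map (conj a) (zipWith _∙_ (map (c ∙_) g ∷ʳ c) (map (_∙ a) h ∷ʳ a))
  ω-zipWith a c []      []      = cong (_∷ []) (sym (trans (cong (_∙ a ⁻¹) (sym (assoc a c a))) (//-rightDividesʳ a (a ∙ c))))
  ω-zipWith a c (x ∷ g) (y ∷ h) = cong₂ _∷_ lemma (ω-zipWith a c g h)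
    where
    open ≡-Reasoning
    lemma : a ∙ c ∙ (x ∙ y) ≡ conj a (c ∙ x ∙ (y ∙ a))
    lemma = sym (begin
      a ∙ (c ∙ x ∙ (y ∙ a)) ∙ a ⁻¹     ≡⟨ cong (λ z → a ∙ z ∙ a ⁻¹) (trans (sym (assoc _ y a)) (cong (_∙ a) (assoc c x y))) ⟩
      a ∙ (c ∙ (x ∙ y) ∙ a) ∙ a ⁻¹     ≡⟨ cong (_∙ a ⁻¹) (trans (sym (assoc a _ a)) (cong (_∙ a) (sym (assoc a c (x ∙ y))))) ⟩
      a ∙ c ∙ (x ∙ y) ∙ a ∙ a ⁻¹       ≡⟨ //-rightDividesʳ a _ ⟩
      a ∙ c ∙ (x ∙ y)                  ∎)

  module _ {m : ℕ} where
    open On m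

    τ-involutive : ∀ g → τ (τ g) ≡ g
    τ-involutive = Vec.reverse-involutive

    -- Read on positions this is `prev-opposite-prev`. It shows that `τ ∘ ω ∘ τ` inverts `ω`.
    ωτω : ∀ g → ω (τ (ω g)) ≡ τ g
    ωτω g = coord-ext opposite-surjective λ i → begin
      coord (ω (τ (ω g))) (opposite i)                  ≡⟨ cong (coord (ω (τ (ω g)))) (sym (prev-opposite-prev i)) ⟩
      coord (ω (τ (ω g))) (prev (opposite (prev i)))    ≡⟨ coord-ω (τ (ω g)) _ ⟩
      coord (τ (ω g)) (opposite (prev i))               ≡⟨ coord-τ (ω g) (prev i) ⟩
      coord (ω g) (prev i) ⁻¹                           ≡⟨ cong _⁻¹ (coord-ω g i) ⟩
      coord g i ⁻¹                                      ≡⟨ sym (coord-τ g i) ⟩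
      coord (τ g) (opposite i)                          ∎
      where open ≡-Reasoning

    ω-inverseˡ : ∀ g → τ (ω (τ (ω g))) ≡ g
    ω-inverseˡ g = trans (cong τ (ωτω g)) (τ-involutive g)

    ω-inverseʳ : ∀ g → ω (τ (ω (τ g))) ≡ g
    ω-inverseʳ g = trans (ωτω (τ g)) (τ-involutive g)

    -- Phrased through equality of letters rather than a letter map, so that it also covers
    -- translations, which change letters differently at different positions.
    relabelling : ∀ {φ φ⁻¹ : Gm → Gm} → (∀ g → φ (φ⁻¹ g) ≡ g) → (∀ g → φ⁻¹ (φ g) ≡ g) →
      ∀ (σ : Fin (suc m) → Fin (suc m)) → (∀ {i j} → σ i ≡ σ j → i ≡ j) → (∀ j → ∃ λ i → σ i ≡ j) →
      (∀ u v i → coord u i ≡ coord v i → coord (φ u) (σ i) ≡ coord (φ v) (σ i)) →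
      (∀ u v i → coord (φ u) (σ i) ≡ coord (φ v) (σ i) → coord u i ≡ coord v i) →
      IsGraphAut φ
    relabelling {φ} {φ⁻¹} invʳ invˡ σ σ-injective σ-surjective pres refl′ =
      ((λ {u} {v} eq → trans (sym (invˡ u)) (trans (cong φ⁻¹ eq) (invˡ v))) ,
       λ v → φ⁻¹ v , λ { refl → invʳ v }) ,
      λ g h → (λ a → forward (adj⇒∼ a)) , (λ a → backward (adj⇒∼ a))
      where
      forward : ∀ {g h} → g ∼ h → Adj (φ g) (φ h)
      forward {g} {h} (i , k , differ i≢k ≢ᵢ ≢ₖ eq) = ∼⇒adj (σ i , σ k , differ (i≢k ∘ σ-injective)
        (≢ᵢ ∘ refl′ g h i) (≢ₖ ∘ refl′ g h k) agree)
        where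
        agree : ∀ j → j ≢ σ i → j ≢ σ k → coord (φ g) j ≡ coord (φ h) j
        agree j j≢σi j≢σk with σ-surjective j
        ... | l , refl = pres g h l (eq l (j≢σi ∘ cong σ) (j≢σk ∘ cong σ))
      backward : ∀ {g h} → φ g ∼ φ h → Adj g h
      backward {g} {h} (i′ , k′ , d) with σ-surjective i′ | σ-surjective k′
      backward {g} {h} (_ , _ , differ σi≢σk ≢ᵢ ≢ₖ eq) | i , refl | k , refl =
        ∼⇒adj (i , k , differ (σi≢σk ∘ cong σ) (≢ᵢ ∘ pres g h i) (≢ₖ ∘ pres g h k)
          λ j j≢i j≢k → refl′ g h j (eq (σ j) (j≢i ∘ σ-injective) (j≢k ∘ σ-injective)))

    monomial-relabelling : ∀ {φ φ⁻¹ : Gm → Gm} → (∀ g → φ (φ⁻¹ g) ≡ g) → (∀ g → φ⁻¹ (φ g) ≡ g) →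
      ∀ (σ : Fin (suc m) → Fin (suc m)) → (∀ {i j} → σ i ≡ σ j → i ≡ j) → (∀ j → ∃ λ i → σ i ≡ j) →
      ∀ (f : Carrier → Carrier) → (∀ {x y} → f x ≡ f y → x ≡ y) →
      (∀ v i → coord (φ v) (σ i) ≡ f (coord v i)) → IsGraphAut φ
    monomial-relabelling invʳ invˡ σ σ-injective σ-surjective f f-injective action =
      relabelling invʳ invˡ σ σ-injective σ-surjective
        (λ u v i eq → trans (action u i) (trans (cong f eq) (sym (action v i))))
        (λ u v i eq → f-injective (trans (sym (action u i)) (trans eq (action v i))))

    graph-aut-gen : ∀ b → IsGraphAut (gen b)
    graph-aut-gen true  = monomial-relabelling {φ⁻¹ = τ} τ-involutive τ-involutive opposite
      opposite-injective opposite-surjective _⁻¹ ⁻¹-injective coord-τ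
    graph-aut-gen false = monomial-relabelling {φ⁻¹ = τ ∘ ω ∘ τ} ω-inverseʳ ω-inverseˡ prev
      prev-injective prev-surjective id id coord-ω

    graph-aut-autₘ : ∀ {f} → IsGroupAut f → IsGraphAut (autₘ f)
    graph-aut-autₘ {f} f-aut = monomial-relabelling {φ⁻¹ = map f⁻¹}
      (λ g → trans (sym (Vec.map-∘ f f⁻¹ g)) (trans (Vec.map-cong ff⁻¹ g) (Vec.map-id g)))
      (λ g → trans (sym (Vec.map-∘ f⁻¹ f g)) (trans (Vec.map-cong (λ x → f-injective (ff⁻¹ (f x))) g) (Vec.map-id g)))
      id id (λ j → j , refl) f f-injective (IsHom.coord-map (group-aut-hom f-aut))
      where
      f-injective : ∀ {x y} → f x ≡ f y → x ≡ y
      f-injective = proj₁ (group-aut-bijective f-aut)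
      f⁻¹ : Carrier → Carrier
      f⁻¹ y = proj₁ (proj₂ (group-aut-bijective f-aut) y)
      ff⁻¹ : ∀ y → f (f⁻¹ y) ≡ y
      ff⁻¹ y = proj₂ (proj₂ (group-aut-bijective f-aut) y)

    ·-assoc : ∀ g h k → (g · h) · k ≡ g · (h · k)
    ·-assoc = Vec.zipWith-assoc assoc

    ·-identityˡ : ∀ g → 𝐞 · g ≡ g
    ·-identityˡ = Vec.zipWith-identityˡ identityˡ

    ·-identityʳ : ∀ g → g · 𝐞 ≡ g
    ·-identityʳ = Vec.zipWith-identityʳ identityʳ

    T-inverseˡ : ∀ g x → T (inv g) (T g x) ≡ x
    T-inverseˡ g x = ·-cancelʳ x g

    T-inverseʳ : ∀ g x → T g (T (inv g) x) ≡ x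
    T-inverseʳ g x = trans (·-assoc x (inv g) g)
      (trans (cong (x ·_) (Vec.zipWith-inverseˡ inverseˡ g)) (·-identityʳ x))

    graph-aut-T : ∀ g → IsGraphAut (T g)
    graph-aut-T g = relabelling {φ⁻¹ = T (inv g)} (T-inverseʳ g) (T-inverseˡ g) id id (λ j → j , refl)
      (λ u v → coord-translate u v g) (λ u v → coord-translate⁻¹ u v g)

    graph-aut-id : IsGraphAut id
    graph-aut-id = (id , λ y → y , id) , λ _ _ → id , id

    graph-aut-∘ : ∀ {φ χ} → IsGraphAut φ → IsGraphAut χ → IsGraphAut (φ ∘ χ)
    graph-aut-∘ {φ} {χ} ((φ-inj , φ-surj) , φ-adj) ((χ-inj , χ-surj) , χ-adj) =
      (χ-inj ∘ φ-inj , λ z → let y , φy≡z = φ-surj z ; x , χx≡y = χ-surj y in x , λ w≡x → φy≡z (χx≡y w≡x)) ,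
      λ g h → proj₁ (φ-adj _ _) ∘ proj₁ (χ-adj g h) , proj₂ (χ-adj g h) ∘ proj₂ (φ-adj _ _)

    graph-aut-≗ : ∀ {φ χ} → φ ≗ χ → IsGraphAut φ → IsGraphAut χ
    graph-aut-≗ φ≗χ ((φ-inj , φ-surj) , φ-adj) =
      ((λ {u} {v} eq → φ-inj (trans (φ≗χ u) (trans eq (sym (φ≗χ v))))) ,
       λ y → let x , φx≡y = φ-surj y in x , λ {z} z≡x → trans (sym (φ≗χ z)) (φx≡y z≡x)) ,
      λ g h → (λ a → subst₂ Adj (φ≗χ g) (φ≗χ h) (proj₁ (φ-adj g h) a)) ,
              (λ a → proj₂ (φ-adj g h) (subst₂ Adj (sym (φ≗χ g)) (sym (φ≗χ h)) a))

    automorphism : ∀ {φ} → IsGraphAut φ → Automorphism m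
    automorphism {φ} ((φ-inj , φ-surj) , φ-adj) = record
      { to         = φ
      ; injective  = φ-inj
      ; surjective = λ v → proj₁ (φ-surj v) , proj₂ (φ-surj v) refl
      ; preserve   = λ {u} {v} u∼v → adj⇒∼ (proj₁ (φ-adj u v) (∼⇒adj u∼v))
      ; reflect    = λ {u} {v} u∼v → adj⇒∼ (proj₂ (φ-adj u v) (∼⇒adj u∼v))
      }

    evalW-aut : ∀ w → IsGraphAut (evalW w)
    evalW-aut []      = graph-aut-id
    evalW-aut (b ∷ w) = graph-aut-∘ (evalW-aut w) (graph-aut-gen b)

    InΔ-aut : ∀ {δ} → InΔ δ → IsGraphAut δ
    InΔ-aut (w , δ≗w) = graph-aut-≗ (λ g → sym (δ≗w g)) (evalW-aut w)

    InΔ-gen : ∀ b → InΔ (gen b)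
    InΔ-gen b = b List.∷ List.[] , λ _ → refl

    InΔ-id : InΔ id
    InΔ-id = List.[] , λ _ → refl

    InΔ-∘ : ∀ {δ δ′} → InΔ δ → InΔ δ′ → InΔ (δ ∘ δ′)
    InΔ-∘ {δ} (w , δ≗w) (v , δ′≗v) = v List.++ w , λ g →
      trans (δ≗w _) (trans (cong (evalW w) (δ′≗v g)) (sym (evalW-++ v w g)))
      where
      evalW-++ : ∀ v w → evalW (v List.++ w) ≗ (evalW w ∘ evalW v)
      evalW-++ []      w g = refl
      evalW-++ (b ∷ v) w g = evalW-++ v w (gen b g)

-- The dihedral group, the factorization and its uniqueness.

module NormalForm (G : FinGroup) (nonAbelian : Cay.NonAbelian G) where

  open FinGroup G
  open Cay G
  open Differences G
  open Adjacency G
  open Lines G nonAbelian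
  open Places G nonAbelian hiding (_·_)
  open MonomialForm G nonAbelian
  open Positions G nonAbelian
  open GraphAutomorphisms G nonAbelian

  private variable
    m : ℕ

  coord-at : ∀ {i k : Fin (3 ℕ.+ m)} → i ≢ k → ∀ x → ∃ λ (v : Vec Carrier (2 ℕ.+ m)) →
    coord v i ≡ x × coord v k ≡ ε
  coord-at {i = i} {k} i≢k x with third i k
  ... | l , i≢l , k≢l with prescribe ((λ _ → ε) [ i ≔ x ]) l
  ...   | v , eq = v , trans (eq i i≢l) (≔-updates (λ _ → ε) i x) ,
          trans (eq k k≢l) (≔-minimal (λ _ → ε) x (≢-sym i≢k))

  -- If `σ′ i` were `σ j` with `j` other than `i`, a word with a nontrivial letter at `i` and `ε` at
  -- `j` would have an image letter there that is trivial by one description and nontrivial by the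
  -- other.
  monomial-unique : ∀ {φ : Vec Carrier (2 ℕ.+ m) → Vec Carrier (2 ℕ.+ m)}
    {σ σ′ : Fin (3 ℕ.+ m) → Fin (3 ℕ.+ m)} {f f′ : Carrier → Carrier} →
    (∀ j → ∃ λ i → σ i ≡ j) → f ε ≡ ε → (∀ x → f′ x ≡ ε → x ≡ ε) →
    (∀ v i → coord (φ v) (σ i) ≡ f (coord v i)) →
    (∀ v i → coord (φ v) (σ′ i) ≡ f′ (coord v i)) →
    (∀ i → σ i ≡ σ′ i) × (∀ x → f x ≡ f′ x)
  monomial-unique {φ = φ} {σ} {σ′} {f} {f′} σ-surjective fε≡ε f′-trivial action action′ =
    σ≡σ′ , λ x → let v , v₀≡x , _ = coord-at {i = zero} {suc zero} (λ ()) x in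
      trans (cong f (sym v₀≡x)) (trans (sym (action v zero))
        (trans (cong (coord (φ v)) (σ≡σ′ zero)) (trans (action′ v zero) (cong f′ v₀≡x))))
    where
    σ≡σ′ : ∀ i → σ i ≡ σ′ i
    σ≡σ′ i with σ-surjective (σ′ i)
    ... | j , σj≡σ′i with i Fin.≟ j
    ...   | yes i≡j  = trans (cong σ i≡j) σj≡σ′i
    ...   | no i≢j   =
      let x , x≢x⁻¹ = nonInvolution
          v , vᵢ≡x , vⱼ≡ε = coord-at i≢j x
          x≡ε = f′-trivial x (trans (cong f′ (sym vᵢ≡x)) (trans (sym (action′ v i))
            (trans (cong (coord (φ v)) (sym σj≡σ′i)) (trans (action v j) (trans (cong f vⱼ≡ε) fε≡ε)))))
      in contradiction (trans x≡ε (sym (trans (cong _⁻¹ x≡ε) ε⁻¹≈ε))) x≢x⁻¹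

  -- The letter part of `ψ d`: reflections invert letters, rotations keep them. The position part is
  -- `turn d`.
  sign : Bool → Carrier → Carrier
  sign true  = _⁻¹
  sign false = id

  sign-ε : ∀ s → sign s ε ≡ ε
  sign-ε true  = ε⁻¹≈ε
  sign-ε false = refl

  sign-trivial : ∀ s x → sign s x ≡ ε → x ≡ ε
  sign-trivial true  x eq = ⁻¹-injective (trans eq (sym ε⁻¹≈ε))
  sign-trivial false x eq = eq

  module _ {m : ℕ} where
    open On m

    gen-commutes : ∀ {f} → IsGroupAut f → ∀ b g → autₘ f (gen b g) ≡ gen b (autₘ f g)
    gen-commutes {f} f-aut true  g = Vec.map-reverse f g
    gen-commutes {f} f-aut false g = coord-ext prev-surjective λ i →
      trans (coord-map (ω g) (prev i)) (trans (cong f (coord-ω g i))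
        (trans (sym (coord-map g i)) (sym (coord-ω (map f g) i))))
      where open IsHom (group-aut-hom f-aut)

    evalW-commutes : ∀ {f} → IsGroupAut f → ∀ w g → autₘ f (evalW w g) ≡ evalW w (autₘ f g)
    evalW-commutes f-aut []      g = refl
    evalW-commutes f-aut (b ∷ w) g =
      trans (evalW-commutes f-aut w (gen b g)) (cong (evalW w) (gen-commutes f-aut b g))

    InΔ-commutes : ∀ {f δ} → IsGroupAut f → InΔ δ → (autₘ f ∘ δ) ≗ (δ ∘ autₘ f)
    InΔ-commutes f-aut (w , δ≗w) g =
      trans (cong (map _) (δ≗w g)) (trans (evalW-commutes f-aut w g) (sym (δ≗w _)))

    map-𝐞 : ∀ {f} → IsGroupAut f → autₘ f 𝐞 ≡ 𝐞
    map-𝐞 {f} f-aut = trans (Vec.map-replicate f ε m) (cong (replicate m) (IsHom.ε-homo (group-aut-hom f-aut)))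

    gen-𝐞 : ∀ b → gen b 𝐞 ≡ 𝐞
    gen-𝐞 true  = coord-ext opposite-surjective λ i →
      trans (coord-τ 𝐞 i) (trans (cong _⁻¹ (coord-𝐞 i)) (trans ε⁻¹≈ε (sym (coord-𝐞 (opposite i)))))
    gen-𝐞 false = coord-ext prev-surjective λ i →
      trans (coord-ω 𝐞 i) (trans (coord-𝐞 i) (sym (coord-𝐞 (prev i))))

    InΔ-𝐞 : ∀ {δ} → InΔ δ → δ 𝐞 ≡ 𝐞
    InΔ-𝐞 (w , δ≗w) = trans (δ≗w 𝐞) (fixed w)
      where
      fixed : ∀ w → evalW w 𝐞 ≡ 𝐞
      fixed []      = refl
      fixed (b ∷ w) = trans (cong (evalW w) (gen-𝐞 b)) (fixed w)

    σ^ : Bool → Gm → Gm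
    σ^ true  = τ
    σ^ false = id

    rotate : ℕ → Gm → Gm
    rotate k g = fold g ω k

    -- Products are read from left to right as right actions: the rotation is applied before the
    -- reflection, and `ψ-hom` composes in reversed order.
    ψ : Dih m → Gm → Gm
    ψ (r , s) g = σ^ s (rotate (toℕ r) g)

    turn : Dih m → Fin (suc m) → Fin (suc m)
    turn (r , true)  i = opposite (fold i prev (toℕ r))
    turn (r , false) i = fold i prev (toℕ r)

    rotate-coord : ∀ k g i → coord (rotate k g) (fold i prev k) ≡ coord g i
    rotate-coord zero    g i = refl
    rotate-coord (suc k) g i = trans (coord-ω (rotate k g) (fold i prev k)) (rotate-coord k g i)

    ψ-coord : ∀ d g i → coord (ψ d g) (turn d i) ≡ sign (proj₂ d) (coord g i)
    ψ-coord (r , true)  g i = trans (coord-τ (rotate (toℕ r) g) (fold i prev (toℕ r)))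
      (cong _⁻¹ (rotate-coord (toℕ r) g i))
    ψ-coord (r , false) g i = rotate-coord (toℕ r) g i

    fold-prev-surjective : ∀ k (j : Fin (suc m)) → ∃ λ i → fold i prev k ≡ j
    fold-prev-surjective zero    j = j , refl
    fold-prev-surjective (suc k) j with prev-surjective j
    ... | i , refl with fold-prev-surjective k i
    ...   | h , eq = h , cong prev eq

    turn-surjective : ∀ d j → ∃ λ i → turn d i ≡ j
    turn-surjective (r , true)  j with fold-prev-surjective (toℕ r) (opposite j)
    ... | i , eq = i , trans (cong opposite eq) (Fin.opposite-involutive j)
    turn-surjective (r , false) j = fold-prev-surjective (toℕ r) j

    InΔ-rotate : ∀ k → InΔ (rotate k)
    InΔ-rotate zero    = InΔ-id
    InΔ-rotate (suc k) = InΔ-∘ (InΔ-gen false) (InΔ-rotate k)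

    InΔ-ψ : ∀ d → InΔ (ψ d)
    InΔ-ψ (r , true)  = InΔ-∘ (InΔ-gen true) (InΔ-rotate (toℕ r))
    InΔ-ψ (r , false) = InΔ-rotate (toℕ r)

    rotate-period : ∀ g → rotate (suc m) g ≡ g
    rotate-period g = coord-injective λ i →
      trans (cong (coord (rotate (suc m) g)) (sym (prev-period i))) (rotate-coord (suc m) g i)

    rotate-+ : ∀ j k g → rotate (j ℕ.+ k) g ≡ rotate j (rotate k g)
    rotate-+ j k g = fold-+ g ω j

    rotate-multiple : ∀ q g → rotate (q ℕ.* suc m) g ≡ g
    rotate-multiple zero    g = refl
    rotate-multiple (suc q) g = trans (rotate-+ (suc m) (q ℕ.* suc m) g)
      (trans (rotate-period _) (rotate-multiple q g))

    rotate-mod : ∀ k g → rotate (toℕ (k mod suc m)) g ≡ rotate k g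
    rotate-mod k g = begin
      rotate (toℕ (k mod suc m)) g                                    ≡⟨ cong (λ j → rotate j g) (Fin.toℕ-fromℕ< (m%n<n k (suc m))) ⟩
      rotate (k % suc m) g                                            ≡⟨ cong (rotate (k % suc m)) (sym (rotate-multiple (k / suc m) g)) ⟩
      rotate (k % suc m) (rotate (k / suc m ℕ.* suc m) g)             ≡⟨ sym (rotate-+ (k % suc m) _ g) ⟩
      rotate (k % suc m ℕ.+ k / suc m ℕ.* suc m) g                    ≡⟨ cong (λ j → rotate j g) (sym (m≡m%n+[m/n]*n k (suc m))) ⟩
      rotate k g                                                      ∎
      where open ≡-Reasoning

    rotate-ω : ∀ k g → rotate k (ω g) ≡ ω (rotate k g)
    rotate-ω k g = fold-comm ω g 1 k

    rotate-τ-rotate : ∀ k g → rotate k (τ (rotate k g)) ≡ τ g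
    rotate-τ-rotate zero    g = refl
    rotate-τ-rotate (suc k) g = trans (sym (rotate-ω k _))
      (trans (cong (rotate k) (ωτω (rotate k g))) (rotate-τ-rotate k g))

    -- A rotation that moves past `τ` is inverted; this is the source of the difference in `dmul`.
    rotate-τ : ∀ {k} → k ℕ.≤ suc m → ∀ g → rotate k (τ g) ≡ τ (rotate (suc m ℕ.∸ k) g)
    rotate-τ {k} k≤n g = begin
      rotate k (τ g)                                       ≡⟨ cong (rotate k ∘ τ) (sym (rotate-period g)) ⟩
      rotate k (τ (rotate (suc m) g))                      ≡⟨ cong (λ j → rotate k (τ (rotate j g))) (sym (ℕ.m+[n∸m]≡n k≤n)) ⟩
      rotate k (τ (rotate (k ℕ.+ (suc m ℕ.∸ k)) g))        ≡⟨ cong (rotate k ∘ τ) (rotate-+ k (suc m ℕ.∸ k) g) ⟩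
      rotate k (τ (rotate k (rotate (suc m ℕ.∸ k) g)))     ≡⟨ rotate-τ-rotate k _ ⟩
      τ (rotate (suc m ℕ.∸ k) g)                           ∎
      where open ≡-Reasoning

    σ^-τ : ∀ s g → σ^ (true xor s) g ≡ σ^ s (τ g)
    σ^-τ true  g = sym (τ-involutive g)
    σ^-τ false g = refl

    ψ-hom : ∀ d d′ → ψ (dmul m d d′) ≗ (ψ d′ ∘ ψ d)
    ψ-hom (r , false) (r′ , s′) g = cong (σ^ s′) (begin
      rotate (toℕ ((toℕ r ℕ.+ toℕ r′) mod suc m)) g     ≡⟨ rotate-mod (toℕ r ℕ.+ toℕ r′) g ⟩
      rotate (toℕ r ℕ.+ toℕ r′) g                       ≡⟨ cong (λ j → rotate j g) (ℕ.+-comm (toℕ r) (toℕ r′)) ⟩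
      rotate (toℕ r′ ℕ.+ toℕ r) g                       ≡⟨ rotate-+ (toℕ r′) (toℕ r) g ⟩
      rotate (toℕ r′) (rotate (toℕ r) g)                ∎)
      where open ≡-Reasoning
    ψ-hom (r , true) (r′ , s′) g = begin
      σ^ (true xor s′) (rotate (toℕ ((toℕ r ℕ.+ c) mod suc m)) g)   ≡⟨ σ^-τ s′ _ ⟩
      σ^ s′ (τ (rotate (toℕ ((toℕ r ℕ.+ c) mod suc m)) g))          ≡⟨ cong (σ^ s′ ∘ τ) (rotate-mod (toℕ r ℕ.+ c) g) ⟩
      σ^ s′ (τ (rotate (toℕ r ℕ.+ c) g))                            ≡⟨ cong (λ j → σ^ s′ (τ (rotate j g))) (ℕ.+-comm (toℕ r) c) ⟩
      σ^ s′ (τ (rotate (c ℕ.+ toℕ r) g))                            ≡⟨ cong (σ^ s′ ∘ τ) (rotate-+ c (toℕ r) g) ⟩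
      σ^ s′ (τ (rotate c (rotate (toℕ r) g)))                       ≡⟨ cong (σ^ s′) (sym (rotate-τ (ℕ.<⇒≤ (Fin.toℕ<n r′)) _)) ⟩
      σ^ s′ (rotate (toℕ r′) (τ (rotate (toℕ r) g)))                ∎
      where
      open ≡-Reasoning
      c = suc m ℕ.∸ toℕ r′

    ψ-surjective : ∀ {δ} → InΔ δ → ∃ λ d → δ ≗ ψ d
    ψ-surjective (w , δ≗w) = let d , w≗d = word w in d , λ g → trans (δ≗w g) (w≗d g)
      where
      generator : ∀ b → ∃ λ d → gen b ≗ ψ d
      generator true  = (zero , true) , λ _ → refl
      -- Reduced modulo `suc m` because for `m = 0` the only rotation is the trivial one.
      generator false = (1 mod suc m , false) , λ g → sym (rotate-mod 1 g)
      word : ∀ w → ∃ λ d → evalW w ≗ ψ d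
      word []      = (zero , false) , λ _ → refl
      word (b ∷ w) = let d₁ , b≗d₁ = generator b ; d₂ , w≗d₂ = word w in dmul m d₁ d₂ , λ g →
        trans (w≗d₂ (gen b g)) (trans (cong (ψ d₂) (b≗d₁ g)) (sym (ψ-hom d₁ d₂ g)))

    gen-T : ∀ b g → ∃₂ λ h f → IsGroupAut f × (∀ x → gen b (x · g) ≡ autₘ f (gen b x · h))
    gen-T true  g       = τ g , id , group-aut-id , λ x →
      trans (reverse-zipWith x g) (sym (Vec.map-id _))
    gen-T false []      = [] , id , group-aut-id , λ { [] → refl }
    gen-T false (y ∷ g) = map (_∙ y ⁻¹) g ∷ʳ y ⁻¹ , conj (y ⁻¹) , conj-aut (y ⁻¹) , λ { (x ∷ xs) →
      trans (cong (λ c → map (c ∙_) (zipWith _∙_ xs g) ∷ʳ c) (⁻¹-anti-homo-∙ x y))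
        (ω-zipWith (y ⁻¹) (x ⁻¹) xs g) }

    -- The automorphism `f` is carried along because each `ω` in the word may add a conjugation,
    -- which then has to pass the remaining generators.
    evalW-T : ∀ w g {f} → IsGroupAut f → ∃₂ λ h f′ → IsGroupAut f′ ×
      (∀ x → evalW w (autₘ f (x · g)) ≡ autₘ f′ (evalW w x · h))
    evalW-T []      g {f} f-aut = g , f , f-aut , λ _ → refl
    evalW-T (b ∷ w) g {f} f-aut =
      let h , k , k-aut , b-T = gen-T b g
          h′ , k′ , k′-aut , w-T = evalW-T w h (group-aut-∘ f-aut k-aut)
      in h′ , k′ , k′-aut , λ x → trans (cong (evalW w) (trans (sym (gen-commutes f-aut b (x · g)))
        (trans (cong (map f) (b-T x)) (sym (Vec.map-∘ f k _))))) (w-T (gen b x))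

    T-normal : ∀ g {f δ} → IsGroupAut f → InΔ δ →
      ∃₂ λ g′ f′ → IsGroupAut f′ × ((δ ∘ autₘ f ∘ T g) ≗ (autₘ f′ ∘ T g′ ∘ δ))
    T-normal g f-aut (w , δ≗w) =
      let g′ , f′ , f′-aut , w-T = evalW-T w g f-aut
      in g′ , f′ , f′-aut , λ x → trans (δ≗w _) (trans (w-T x) (cong (λ y → autₘ f′ (y · g′)) (sym (δ≗w x))))

  module _ {m₀ : ℕ} where
    open On (2 ℕ.+ m₀)

    -- A letter that is not its own inverse detects the reflection; the image of position `zero`
    -- detects the amount of rotation.
    ψ-injective : ∀ d d′ → ψ d ≗ ψ d′ → d ≡ d′
    ψ-injective d@(r , s) d′@(r′ , s′) ψd≗ψd′ = equal s s′ (proj₁ unique zero) (proj₂ unique)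
      where
      unique = monomial-unique {φ = ψ d} {turn d} {turn d′} {sign s} {sign s′}
        (turn-surjective d) (sign-ε s) (sign-trivial s′) (ψ-coord d)
        (λ v i → trans (cong (λ g → coord g (turn d′ i)) (ψd≗ψd′ v)) (ψ-coord d′ v i))
      x = proj₁ nonInvolution
      r-equal : fold zero (prev {2 ℕ.+ m₀}) (toℕ r) ≡ fold zero prev (toℕ r′) → r ≡ r′
      r-equal eq = Fin.toℕ-injective
        (prev-iterate-injective (s≤s⁻¹ (Fin.toℕ<n r)) (s≤s⁻¹ (Fin.toℕ<n r′)) eq)
      equal : ∀ s s′ → turn (r , s) zero ≡ turn (r′ , s′) zero → (∀ x → sign s x ≡ sign s′ x) →
        (r , s) ≡ (r′ , s′)
      equal true  true  eq _  = cong (_, true) (r-equal (opposite-injective eq))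
      equal false false eq _  = cong (_, false) (r-equal eq)
      equal true  false _  eq = contradiction (sym (eq x)) (proj₂ nonInvolution)
      equal false true  _  eq = contradiction (eq x) (proj₂ nonInvolution)

    -- By `monomial-unique` the map `f` is the identity or inversion, and inversion is a
    -- homomorphism only in an abelian group.
    autₘ-InΔ-trivial : ∀ {f δ} → IsGroupAut f → InΔ δ → autₘ f ≗ δ → autₘ f ≗ id
    autₘ-InΔ-trivial {f} {δ} f-aut δ∈Δ f≗δ with ψ-surjective δ∈Δ
    ... | d@(r , s) , δ≗ψ = trivial s (proj₂ unique)
      where
      open IsHom (group-aut-hom f-aut)
      unique = monomial-unique {φ = autₘ f} {id} {turn d} {f} {sign s}
        (λ j → j , refl) ε-homo (sign-trivial s) coord-map
        (λ v i → trans (cong (λ g → coord g (turn d i)) (trans (f≗δ v) (δ≗ψ v))) (ψ-coord d v i))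
      trivial : ∀ s → (∀ x → f x ≡ sign s x) → autₘ f ≗ id
      trivial false f≡id g = trans (Vec.map-cong f≡id g) (Vec.map-id g)
      trivial true  f≡⁻¹ _ = ⊥-elim (nonAbelian λ x y → ⁻¹-injective (begin
        (x ∙ y) ⁻¹      ≡⟨ sym (f≡⁻¹ (x ∙ y)) ⟩
        f (x ∙ y)       ≡⟨ homo x y ⟩
        f x ∙ f y       ≡⟨ cong₂ _∙_ (f≡⁻¹ x) (f≡⁻¹ y) ⟩
        x ⁻¹ ∙ y ⁻¹     ≡⟨ sym (⁻¹-anti-homo-∙ y x) ⟩
        (y ∙ x) ⁻¹      ∎))
        where open ≡-Reasoning

    -- Induction on the place of position 0, which composition with `ω` lowers by one. Once position
    -- 0 is fixed, the triples starting with it show that `π` is increasing, hence the identity.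
    direct-normal-form : ∀ t {φ : Gm → Gm} (M : Monomial φ) → Monomial.Direct M → toℕ (Monomial.π M zero) ≡ t →
      ∃ λ δ → InΔ δ × (φ ≗ (δ ∘ autₘ (Monomial.f M)))
    direct-normal-form zero {φ} M (π-cyclic , homo) π₀≡0 = id , InΔ-id , λ g → coord-injective λ i →
      trans (cong (coord (φ g)) (sym (strictlyMonotone⇒id π π-mono i)))
        (trans (action g i) (sym (IsHom.coord-map (record { homo = homo }) g i)))
      where
      open Monomial M
      π₀≡zero : π zero ≡ zero
      π₀≡zero = Fin.toℕ-injective π₀≡0
      -- `Monomial` does not record that `π` is injective; here it follows from the cyclic order of
      -- any triple containing `i` and `j`.
      π-distinct : ∀ {i j} → i ≢ j → π i ≢ π j
      π-distinct {i} {j} i≢j with third i j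
      ... | k , i≢k , j≢k with cyclic-total i≢j i≢k j≢k
      ...   | inj₁ cyc = proj₁ (cyclic-distinct (π-cyclic cyc))
      ...   | inj₂ cyc = proj₁ (proj₂ (cyclic-distinct (π-cyclic cyc)))
      linear : ∀ {i j} → Cyclic (π zero) (π i) (π j) → π i Fin.< π j
      linear (ijk _ i<j) = i<j
      linear (jki i<j _) = i<j
      linear {j = j} (kij j<0 _) = contradiction (subst (toℕ (π j) ℕ.<_) π₀≡0 j<0) λ ()
      π-mono : ∀ {i j} → i Fin.< j → π i Fin.< π j
      π-mono {zero}  {suc j} _   = subst (ℕ._< toℕ (π (suc j))) (sym π₀≡0)
        (ℕ.n≢0⇒n>0 λ πj≡0 → π-distinct {zero} {suc j} (λ ()) (trans π₀≡zero (sym (Fin.toℕ-injective πj≡0))))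
      π-mono {suc i} {suc j} i<j = linear (π-cyclic (ijk z<s i<j))
    direct-normal-form (suc t) {φ} M (π-cyclic , homo) π₀≡t = let δ , δ∈Δ , ωφ≗δf = turned in
      τ ∘ ω ∘ τ ∘ δ ,
      InΔ-∘ (InΔ-gen true) (InΔ-∘ (InΔ-gen false) (InΔ-∘ (InΔ-gen true) δ∈Δ)) ,
      λ g → trans (sym (ω-inverseˡ (φ g))) (cong (τ ∘ ω ∘ τ) (ωφ≗δf g))
      where
      open Monomial M
      prev-decrements : ∀ {n t} (i : Fin (suc n)) → toℕ i ≡ suc t → toℕ (prev i) ≡ t
      prev-decrements (suc i) eq = trans (Fin.toℕ-inject₁ i) (ℕ.suc-injective eq)
      turned : ∃ λ δ → InΔ δ × ((ω ∘ φ) ≗ (δ ∘ autₘ f))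
      turned = direct-normal-form t {ω ∘ φ}
        (record { π = prev ∘ π ; f = f ; bijective = bijective
                ; action = λ v i → trans (coord-ω (φ v) (π i)) (action v i) })
        ((λ cyc → cyclic-prev (π-cyclic cyc)) , homo) (prev-decrements (π zero) π₀≡t)

    stabilizer-normal-form : ∀ φ → IsGraphAut φ → φ 𝐞 ≡ 𝐞 →
      ∃ λ f → ∃ λ δ → IsGroupAut f × InΔ δ × (φ ≗ (δ ∘ autₘ f))
    stabilizer-normal-form φ φ-aut φ𝐞≡𝐞 =
      [ (λ direct → let δ , δ∈Δ , φ≗ = direct-normal-form _ M direct refl in
           f , δ , bijective⇒group-aut bijective (proj₂ direct) , δ∈Δ , φ≗)
      , reversed-case ]′ (direct-or-reversed (automorphism φ-aut) φ𝐞≡𝐞)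
      where
      M : Monomial φ
      M = monomial (automorphism φ-aut) φ𝐞≡𝐞
      open Monomial M
      reversed-case : Reversed → ∃ λ f → ∃ λ δ → IsGroupAut f × InΔ δ × (φ ≗ (δ ∘ autₘ f))
      -- Composing with `τ` reverses the cyclic order again and follows `f` by inversion, which
      -- turns an antihomomorphism into a homomorphism.
      reversed-case (π-cyclic , anti) =
        let δ , δ∈Δ , τφ≗ = direct-normal-form _ {τ ∘ φ} τM (cyclic , homo) refl in
        _⁻¹ ∘ f , τ ∘ δ , bijective⇒group-aut (Monomial.bijective τM) homo , InΔ-∘ (InΔ-gen true) δ∈Δ ,
        λ g → trans (sym (τ-involutive (φ g))) (cong τ (τφ≗ g))
        where
        τM : Monomial (τ ∘ φ)
        τM = record
          { π         = opposite ∘ π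
          ; f         = _⁻¹ ∘ f
          ; action    = λ v i → trans (coord-τ (φ v) (π i)) (cong _⁻¹ (action v i))
          ; bijective = bijective-∘ (⁻¹-injective , λ x → x ⁻¹ , ⁻¹-involutive x) bijective
          }
        cyclic : ∀ {i j k} → Cyclic i j k → Cyclic (opposite (π i)) (opposite (π j)) (opposite (π k))
        cyclic cyc = cyclic-opposite (π-cyclic cyc)
        homo : ∀ x y → f (x ∙ y) ⁻¹ ≡ f x ⁻¹ ∙ f y ⁻¹
        homo x y = trans (cong _⁻¹ (anti x y)) (⁻¹-anti-homo-∙ (f y) (f x))

    normal-form : ∀ φ → IsGraphAut φ →
      ∃ λ g → ∃ λ f → ∃ λ δ → IsGroupAut f × InΔ δ × (φ ≗ (δ ∘ autₘ f ∘ T g))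
    normal-form φ φ-aut@((_ , φ-surj) , _) =
      -- `T g` sends `𝐞` to the preimage `g` of `𝐞`, so `φ ∘ T g` lies in the stabilizer.
      let g , φg≡𝐞 = φ-surj 𝐞
          f , δ , f-aut , δ∈Δ , φTg≗ = stabilizer-normal-form (φ ∘ T g) (graph-aut-∘ φ-aut (graph-aut-T g))
            (φg≡𝐞 (·-identityˡ g))
      in inv g , f , δ , f-aut , δ∈Δ , λ x →
        trans (cong φ (sym (T-inverseʳ g x))) (φTg≗ (T (inv g) x))

    -- Evaluation at `𝐞`, which both `δ` and `autₘ f` fix, forces `g ≡ 𝐞`; then `autₘ-InΔ-trivial`
    -- applies.
    T-autₘ-InΔ-trivial : ∀ g {f δ} → IsGroupAut f → InΔ δ → (autₘ f ∘ T g) ≗ δ → δ ≗ id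
    T-autₘ-InΔ-trivial g {f} {δ} f-aut δ∈Δ fT≗δ x =
      trans (sym (f≗δ x)) (autₘ-InΔ-trivial f-aut δ∈Δ f≗δ x)
      where
      g≡𝐞 : g ≡ 𝐞
      g≡𝐞 = proj₁ (proj₁ (graph-aut-autₘ f-aut)) (begin
        autₘ f g           ≡⟨ cong (autₘ f) (sym (·-identityˡ g)) ⟩
        autₘ f (𝐞 · g)     ≡⟨ fT≗δ 𝐞 ⟩
        δ 𝐞                ≡⟨ InΔ-𝐞 δ∈Δ ⟩
        𝐞                  ≡⟨ sym (map-𝐞 f-aut) ⟩
        autₘ f 𝐞           ∎)
        where open ≡-Reasoning
      f≗δ : autₘ f ≗ δ
      f≗δ y = trans (cong (autₘ f) (sym (trans (cong (y ·_) g≡𝐞) (·-identityʳ y)))) (fT≗δ y)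

theorem6p10 : (G : FinGroup) → Cay.NonAbelian G → (m : ℕ) → 1 < m →
  let open FinGroup G
      open Cay G
      open Cay.On G m
  in
  -- (1) Stab(𝐞) = Aut_m(G) × Δ_m (internal direct product) ≅ Aut(G) × D_{m+1}
  ( (∀ φ → IsGraphAut φ → φ 𝐞 ≡ 𝐞 →
       ∃[ f ] ∃[ δ ] (IsGroupAut f × InΔ δ × (φ ≗ (δ ∘ autₘ f))))
  × (∀ f δ → IsGroupAut f → InΔ δ →
       IsGraphAut (δ ∘ autₘ f) × ((δ ∘ autₘ f) 𝐞 ≡ 𝐞))
  × (∀ f δ → IsGroupAut f → InΔ δ → (autₘ f ∘ δ) ≗ (δ ∘ autₘ f))
  × (∀ f δ → IsGroupAut f → InΔ δ → autₘ f ≗ δ → autₘ f ≗ id)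
  × (∀ f f′ → IsGroupAut f → IsGroupAut f′ → autₘ f ≗ autₘ f′ → f ≗ f′)
  × (Σ (Dih m → (Gm → Gm)) λ ψ →
         (∀ d → InΔ (ψ d))
       × (∀ δ → InΔ δ → ∃[ d ] (δ ≗ ψ d))
       × (∀ d d′ → ψ d ≗ ψ d′ → d ≡ d′)
       × (∀ d d′ → ψ (dmul m d d′) ≗ (ψ d′ ∘ ψ d))) )
  ×
  -- (2) Aut(𝒢_m(G)) = (T_m ⋊ Aut_m(G)) ⋊ Δ_m ≅ (G^m ⋊ Aut(G)) ⋊ D_{m+1}
  ( (∀ φ → IsGraphAut φ →
       ∃[ g ] ∃[ f ] ∃[ δ ] (IsGroupAut f × InΔ δ × (φ ≗ (δ ∘ autₘ f ∘ T g))))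
  × (∀ g f δ → IsGroupAut f → InΔ δ → IsGraphAut (δ ∘ autₘ f ∘ T g))
  × (∀ g g′ → T g ≗ T g′ → g ≡ g′)
  × (∀ g g′ → T (g · g′) ≗ (T g′ ∘ T g))
  × (∀ g f → IsGroupAut f → ∃[ g′ ] ((autₘ f ∘ T g) ≗ (T g′ ∘ autₘ f)))
  × (∀ g f → IsGroupAut f → T g ≗ autₘ f → g ≡ 𝐞)
  × (∀ g f δ → IsGroupAut f → InΔ δ →
       ∃[ g′ ] ∃[ f′ ] (IsGroupAut f′ × ((δ ∘ autₘ f ∘ T g) ≗ (autₘ f′ ∘ T g′ ∘ δ))))
  × (∀ g f δ → IsGroupAut f → InΔ δ → (autₘ f ∘ T g) ≗ δ → δ ≗ id) )
theorem6p10 G nonAbelian (suc zero) (s≤s ())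
theorem6p10 G nonAbelian (suc (suc m₀)) _ =
  ( stabilizer-normal-form
  , (λ f δ f-aut δ∈Δ → graph-aut-∘ (InΔ-aut δ∈Δ) (graph-aut-autₘ f-aut) ,
      trans (cong δ (map-𝐞 f-aut)) (InΔ-𝐞 δ∈Δ))
  , (λ f δ → InΔ-commutes)
  , (λ f δ → autₘ-InΔ-trivial)
  , (λ f f′ _ _ f≗f′ x → Vec.∷-injectiveˡ (f≗f′ (replicate m x)))
  , ψ , InΔ-ψ , (λ δ → ψ-surjective) , ψ-injective , ψ-hom )
  ,
  ( normal-form
  , (λ g f δ f-aut δ∈Δ →
      graph-aut-∘ (InΔ-aut δ∈Δ) (graph-aut-∘ (graph-aut-autₘ f-aut) (graph-aut-T g)))
  , (λ g g′ T≗T′ → trans (sym (·-identityˡ g)) (trans (T≗T′ 𝐞) (·-identityˡ g′)))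
  , (λ g g′ x → sym (·-assoc x g g′))
  , (λ g f f-aut → map f g , λ x → map-zipWith (proj₂ f-aut) x g)
  , (λ g f f-aut T≗f → trans (sym (·-identityˡ g)) (trans (T≗f 𝐞) (map-𝐞 f-aut)))
  , (λ g f δ → T-normal g)
  , (λ g f δ → T-autₘ-InΔ-trivial g) )
  where
  m : ℕ
  m = suc (suc m₀)
  open FinGroup G
  open Cay G
  open On m
  open GraphAutomorphisms G nonAbelian
  open NormalForm G nonAbelian
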